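{- Let $G$ be a graph having a component with at least two cycles, and let $F$ be a subgraph of $G$. The following are equivalent: (a1) $F=[G]$, the core of $G$; (a2) $F$ is the unique maximum (with respect to the subgraph relation) element among the subgraphs of $G$ that are cacti-graphs; (a3) letting $G'$ be the graph obtained from $G$ by removing all tree components, $F$ is the only subgraph of $G$ that is a cacti-graph and satisfies $\Delta F=\Delta G'$.
   Context: Graphs are finite, may have loops and parallel edges, and have no isolated vertices unless stated otherwise. A leaf is a vertex incident to exactly one edge, which is not a loop. $\Delta G=|E(G)|-|V(G)|$. For $X\subseteq E(G)$, $G\langle X\rangle$ is the subgraph with edge set $X$ and vertex set the vertices incident to edges of $X$. A cycle is a connected graph all of whose vertices have degree 2 (a loop contributes 2). A cacti-graph is a graph with no isolated vertices, no leaves, and no component that is a cycle. For a connected graph $A$ containing a cycle, its kernel $\lfloor A\rfloor$ is the subgraph obtained from $A$ by repeatedly deleting leaves (with their incident edges) until no leaf remains; equivalently $\lfloor A\rfloor=A\langle X\rangle$ where $X$ is the inclusion-minimum nonempty subset of $E(A)$ with $\Delta A\langle X\rangle=\Delta A$. If $G$ has a component with at least two cycles, the core $[G]$ of $G$ is the union of the kernels $\lfloor A\rfloor$ over the components $A$ of $G$ with $\Delta A\ge1$ (i.e. with at least two cycles). -}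

module Defs where

open import Data.Fin using (Fin; _≟_)
import Data.Fin.Subset as Subset
open Subset using (Subset; _∈_; _∉_; ∣_∣; _∩_; _-_)
open import Data.Fin.Subset.Properties using (∈⊤)
open import Data.Integer as ℤ using (ℤ; _⊖_)
open import Data.Nat using (ℕ; _+_)
open import Data.Product using (∃; ∃₂; _×_; _,_)
open import Data.Sum using (_⊎_)
open import Data.Vec using (tabulate)
open import Function.Bundles using (_⇔_)
open import Relation.Binary.Construct.Closure.ReflexiveTransitive using (Star)
open import Relation.Binary.PropositionalEquality using (_≡_)
open import Relation.Nullary using (¬_)
open import Relation.Nullary.Decidable using (does)

-- A finite undirected multigraph.  The order of the two ends of an edge
-- carries no meaning: all notions below are symmetric in end₁ and end₂.
record Graph : Set where
  field
    #V #E     : ℕ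
    end₁ end₂ : Fin #E → Fin #V

-- A subgraph may have isolated vertices; NoIsolated below excludes them.
-- It may also be empty.
record Subgraph (G : Graph) : Set where
  open Graph G
  field
    vertices : Subset #V
    edges    : Subset #E
    closed   : ∀ {e} → e ∈ edges → end₁ e ∈ vertices × end₂ e ∈ vertices

open Subgraph public

whole : (G : Graph) → Subgraph G
whole G = record
  { vertices = Subset.⊤
  ; edges    = Subset.⊤
  ; closed   = λ _ → ∈⊤ , ∈⊤
  }

module _ {G : Graph} where
  open Graph G

  infix 4 _⊆_ _≈_

  _⊆_ : Subgraph G → Subgraph G → Set
  H ⊆ K = vertices H Subset.⊆ vertices K × edges H Subset.⊆ edges K

  _≈_ : Subgraph G → Subgraph G → Set
  H ≈ K = vertices H ≡ vertices K × edges H ≡ edges K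

  Δ : Subgraph G → ℤ
  Δ H = ∣ edges H ∣ ⊖ ∣ vertices H ∣

  Incident : Fin #E → Fin #V → Set
  Incident e v = end₁ e ≡ v ⊎ end₂ e ≡ v

  Loop : Fin #E → Set
  Loop e = end₁ e ≡ end₂ e

  NoIsolated : Subgraph G → Set
  NoIsolated H = ∀ {v} → v ∈ vertices H → ∃ λ e → e ∈ edges H × Incident e v

  fibre : (Fin #E → Fin #V) → Fin #V → Subset #E
  fibre end v = tabulate λ e → does (end e ≟ v)

  -- A loop at v lies in both fibres, hence contributes 2.
  degree : Subgraph G → Fin #V → ℕ
  degree H v = ∣ edges H ∩ fibre end₁ v ∣ + ∣ edges H ∩ fibre end₂ v ∣

  Adjacent : Subgraph G → Fin #V → Fin #V → Set
  Adjacent H u v = ∃ λ e → e ∈ edges H ×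
    ((end₁ e ≡ u × end₂ e ≡ v) ⊎ (end₁ e ≡ v × end₂ e ≡ u))

  Connected : Subgraph G → Set
  Connected H = Subset.Nonempty (vertices H) ×
    (∀ {u v} → u ∈ vertices H → v ∈ vertices H → Star (Adjacent H) u v)

  IsComponent : Subgraph G → Subgraph G → Set
  IsComponent H A = A ⊆ H × Connected A ×
    (∀ B → B ⊆ H → Connected B → A ⊆ B → B ⊆ A)

  IsCycle : Subgraph G → Set
  IsCycle C = Connected C × (∀ {v} → v ∈ vertices C → degree C v ≡ 2)

  IsTree : Subgraph G → Set
  IsTree T = Connected T × (∀ C → C ⊆ T → ¬ IsCycle C)

  AtLeastTwoCycles : Subgraph G → Set
  AtLeastTwoCycles H = ∃₂ λ C D →
    (C ⊆ H × IsCycle C) × (D ⊆ H × IsCycle D) × ¬ (C ≈ D)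

  -- v is a leaf of H, and e is the edge incident to it.
  LeafWithEdge : Subgraph G → Fin #V → Fin #E → Set
  LeafWithEdge H v e =
    v ∈ vertices H × e ∈ edges H × Incident e v × ¬ Loop e ×
    (∀ {e′} → e′ ∈ edges H → Incident e′ v → e′ ≡ e)

  IsLeaf : Subgraph G → Fin #V → Set
  IsLeaf H v = ∃ λ e → LeafWithEdge H v e

  NoLeaves : Subgraph G → Set
  NoLeaves H = ∀ v → ¬ IsLeaf H v

  IsCacti : Subgraph G → Set
  IsCacti H = NoIsolated H × NoLeaves H × (∀ A → IsComponent H A → ¬ IsCycle A)

  infix 4 _⇝_

  _⇝_ : Subgraph G → Subgraph G → Set
  H ⇝ K = ∃₂ λ v e → LeafWithEdge H v e ×
    vertices K ≡ vertices H - v × edges K ≡ edges H - e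

  -- K = ⌊ A ⌋, for A connected and containing a cycle.
  IsKernel : Subgraph G → Subgraph G → Set
  IsKernel A K = Star _⇝_ A K × NoLeaves K

  IsUnion : (Subgraph G → Set) → Subgraph G → Set
  IsUnion P U =
    (∀ v → v ∈ vertices U ⇔ (∃ λ K → P K × v ∈ vertices K)) ×
    (∀ e → e ∈ edges U ⇔ (∃ λ K → P K × e ∈ edges K))

  -- C = [ H ].
  IsCore : Subgraph G → Subgraph G → Set
  IsCore H C = IsUnion
    (λ K → ∃ λ A → IsComponent H A × ℤ.+ 1 ℤ.≤ Δ A × IsKernel A K) C

  TreeComponent : Subgraph G → Subgraph G → Set
  TreeComponent H T = IsComponent H T × IsTree T

  -- H′ is H with all its tree components removed.
  RemovesTrees : Subgraph G → Subgraph G → Set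
  RemovesTrees H H′ =
    (∀ v → v ∈ vertices H′ ⇔
      (v ∈ vertices H × (∀ T → TreeComponent H T → v ∉ vertices T))) ×
    (∀ e → e ∈ edges H′ ⇔
      (e ∈ edges H × (∀ T → TreeComponent H T → e ∉ edges T)))

  IsMaximum : (Subgraph G → Set) → Subgraph G → Set
  IsMaximum P F = P F × (∀ H → P H → H ⊆ F)

  IsUnique : (Subgraph G → Set) → Subgraph G → Set
  IsUnique P F = P F × (∀ H → P H → H ≈ F)

{-# OPTIONS --safe #-}
module Submission where

-- If A is connected and X ⊆ A has a vertex, then X grows to A by adding one touching edge at a
-- time; such an edge keeps Δ if it brings a new vertex and increases Δ otherwise, and a new vertex
-- brought by the last edge is a leaf of A.  Hence Δ X ≤ Δ A, with equality only for X = A when A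
-- has no leaves.  Pruning leaves keeps Δ and connectedness and never touches a subgraph without
-- leaves and isolated vertices.  By the handshake lemma such a connected subgraph has Δ ≥ 1 unless
-- it is a cycle, so every component of a cacti-graph lies in a component of G with Δ ≥ 1, and
-- there in its kernel.  So the core is the maximum cacti-graph.  A component of G is a tree iff
-- Δ < 0 on it, so summing Δ over the components of G, those with Δ = 0 contributing nothing, gives
-- Δ core = Δ G′.  A smaller cacti-graph has a smaller Δ on some component.

open import Defs
open import Data.Product using (∃; _×_)
open import Function.Bundles using (_⇔_)
open import Relation.Binary.PropositionalEquality using (_≡_)

open import Algebra.Bundles using (CommutativeMonoid)
import Algebra.Properties.CommutativeMonoid.Sum as Sum
open import Data.Bool using (true; false; if_then_else_)
open import Data.Empty using (⊥-elim)
open import Data.Fin using (Fin; zero; suc; _≟_)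
open import Data.Fin.Properties using (any?; all?)
import Data.Fin.Subset as Subset
open Subset using (Subset; _∈_; _∉_; ∣_∣; _∩_; _∪_; _-_; ⁅_⁆; inside; outside)
open import Data.Fin.Subset.Properties hiding (⊆-refl; ⊆-trans; ⊆-antisym)
import Data.Fin.Subset.Properties as Subset
open import Data.Integer as ℤ using (ℤ; _⊖_; +_)
import Data.Integer.Properties as ℤ
open import Data.Integer.Tactic.RingSolver using () renaming (solve-∀ to ℤ-solve-∀)
open import Data.List using (List; []; _∷_; allFin)
open import Data.List.Membership.Propositional using () renaming (_∈_ to _∈ˡ_)
open import Data.List.Membership.Propositional.Properties using (∈-allFin)
open import Data.List.Relation.Unary.Any using () renaming (here to hereˡ; there to thereˡ)
open import Data.Nat as ℕ using (ℕ; zero; suc; _+_; z≤n; s≤s)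
import Data.Nat.Properties as ℕ
open import Data.Product using (_,_; proj₁; proj₂; map₂)
open import Data.Sum using (_⊎_; inj₁; inj₂; [_,_]′; swap)
open import Data.Vec using (_∷_; []; tabulate; here; there; lookup)
open import Data.Vec.Properties using (lookup∘tabulate; lookup⇒[]=; []=⇒lookup)
open import Function using (_∘_; id)
open import Function.Bundles using (mk⇔; Equivalence)
open import Function.Construct.Composition using (_⇔-∘_)
open import Function.Construct.Symmetry using (⇔-sym)
open import Level using (0ℓ)
open import Relation.Binary using (Rel; Reflexive)
open import Relation.Binary.Construct.Closure.ReflexiveTransitive
  using (Star; ε; _◅_; _◅◅_; kleisliStar)
  renaming (map to Star-map)
open import Relation.Binary.Definitions using (Monotonic₂)
open import Relation.Binary.PropositionalEquality
  using (_≢_; refl; sym; trans; cong; cong₂; subst; subst₂; module ≡-Reasoning)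
open import Relation.Nullary using (¬_; Dec; yes; no; contradiction)
open import Relation.Nullary.Decidable
  using (does; dec-true; _×-dec_; _⊎-dec_; _→-dec_; ¬?; map′; decidable-stable)

-- Sums and differences

module ℕΣ = Sum ℕ.+-0-commutativeMonoid
module ℤΣ = Sum ℤ.+-0-commutativeMonoid

-- Instantiated over ℕ to compare degrees with 2 vertex by vertex, and over ℤ to compare `Δ`
-- component by component. One strict summand makes the whole sum strict.
module MonotoneSum
  (M : CommutativeMonoid 0ℓ 0ℓ)
  (_≤_ _<_ : Rel (CommutativeMonoid.Carrier M) 0ℓ)
  (≤-refl : Reflexive _≤_)
  (∙-mono-≤ : Monotonic₂ _≤_ _≤_ _≤_ (CommutativeMonoid._∙_ M))
  (∙-mono-<-≤ : Monotonic₂ _<_ _≤_ _<_ (CommutativeMonoid._∙_ M))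
  (∙-mono-≤-< : Monotonic₂ _≤_ _<_ _<_ (CommutativeMonoid._∙_ M))
  where

  open CommutativeMonoid M using (Carrier)
  open Sum M using (sum)

  sum-mono-≤ : ∀ {n} {f g : Fin n → Carrier} → (∀ i → f i ≤ g i) → sum f ≤ sum g
  sum-mono-≤ {zero}  f≤g = ≤-refl
  sum-mono-≤ {suc n} f≤g = ∙-mono-≤ (f≤g zero) (sum-mono-≤ (f≤g ∘ suc))

  sum-mono-< : ∀ {n} {f g : Fin n → Carrier} → (∀ i → f i ≤ g i) →
    ∀ i → f i < g i → sum f < sum g
  sum-mono-< f≤g zero    fi<gi = ∙-mono-<-≤ fi<gi (sum-mono-≤ (f≤g ∘ suc))
  sum-mono-< f≤g (suc i) fi<gi = ∙-mono-≤-< (f≤g zero) (sum-mono-< (f≤g ∘ suc) i fi<gi)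

module ℕ-MonotoneSum = MonotoneSum ℕ.+-0-commutativeMonoid ℕ._≤_ ℕ._<_
  ℕ.≤-refl ℕ.+-mono-≤ ℕ.+-mono-<-≤ ℕ.+-mono-≤-<
module ℤ-MonotoneSum = MonotoneSum ℤ.+-0-commutativeMonoid ℤ._≤_ ℤ._<_
  ℤ.≤-refl ℤ.+-mono-≤ ℤ.+-mono-<-≤ ℤ.+-mono-≤-<

⊖-+-⊖ : ∀ a b c d → (a ⊖ b) ℤ.+ (c ⊖ d) ≡ (a + c) ⊖ (b + d)
⊖-+-⊖ a b c d = begin
  (a ⊖ b) ℤ.+ (c ⊖ d)             ≡⟨ sym (cong₂ ℤ._+_ (ℤ.m-n≡m⊖n a b) (ℤ.m-n≡m⊖n c d)) ⟩
  (+ a ℤ.- + b) ℤ.+ (+ c ℤ.- + d) ≡⟨ interchange (+ a) (+ b) (+ c) (+ d) ⟩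
  + (a + c) ℤ.- + (b + d)         ≡⟨ ℤ.m-n≡m⊖n (a + c) (b + d) ⟩
  (a + c) ⊖ (b + d)               ∎
  where
  open ≡-Reasoning
  interchange : ∀ i j k l → (i ℤ.- j) ℤ.+ (k ℤ.- l) ≡ (i ℤ.+ k) ℤ.- (j ℤ.+ l)
  interchange = ℤ-solve-∀

sum-⊖ : ∀ {n} (f g : Fin n → ℕ) → ℤΣ.sum (λ i → f i ⊖ g i) ≡ ℕΣ.sum f ⊖ ℕΣ.sum g
sum-⊖ {zero}  f g = refl
sum-⊖ {suc n} f g = trans
  (cong (ℤ._+_ (f zero ⊖ g zero)) (sum-⊖ (f ∘ suc) (g ∘ suc)))
  (⊖-+-⊖ (f zero) (g zero) _ _)

m<n⇒0<n⊖m : ∀ {m n} → m ℕ.< n → + 0 ℤ.< n ⊖ m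
m<n⇒0<n⊖m {m} {n} m<n = subst (ℤ._< (n ⊖ m)) (ℤ.n⊖n≡0 m) (ℤ.⊖-monoˡ-< m m<n)

0≤n⊖m⇒m≤n : ∀ {m n} → + 0 ℤ.≤ n ⊖ m → m ℕ.≤ n
0≤n⊖m⇒m≤n {m} {n} 0≤ = ℕ.≮⇒≥ λ n<m → ℤ.≤⇒≯ 0≤ (subst ((n ⊖ m) ℤ.<_) (ℤ.n⊖n≡0 m) (ℤ.⊖-monoˡ-< m n<m))

0<n⊖m⇒m<n : ∀ {m n} → + 0 ℤ.< n ⊖ m → m ℕ.< n
0<n⊖m⇒m<n {m} {n} 0< = ℕ.≰⇒> λ n≤m → ℤ.<⇒≱ 0< (subst ((n ⊖ m) ℤ.≤_) (ℤ.n⊖n≡0 m) (ℤ.⊖-monoˡ-≤ m n≤m))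

m+m≤n+n⇒m≤n : ∀ {m n} → m + m ℕ.≤ n + n → m ℕ.≤ n
m+m≤n+n⇒m≤n m+m≤n+n = ℕ.≮⇒≥ λ n<m → ℕ.<⇒≱ (ℕ.+-mono-< n<m n<m) m+m≤n+n

m+m<n+n⇒m<n : ∀ {m n} → m + m ℕ.< n + n → m ℕ.< n
m+m<n+n⇒m<n m+m<n+n = ℕ.≰⇒> λ n≤m → ℕ.<⇒≱ m+m<n+n (ℕ.+-mono-≤ n≤m n≤m)

-- Subsets of finite sets

private variable
  m n : ℕ

sift : {P : Fin n → Set} → (∀ x → Dec (P x)) → Subset n
sift P? = tabulate (does ∘ P?)

module _ {P : Fin n → Set} (P? : ∀ x → Dec (P x)) where

  ∈-sift⁺ : ∀ {x} → P x → x ∈ sift P?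
  ∈-sift⁺ {x} px = lookup⇒[]= x _ (trans (lookup∘tabulate _ x) (dec-true (P? x) px))

  ∈-sift⁻ : ∀ {x} → x ∈ sift P? → P x
  ∈-sift⁻ {x} x∈ with P? x | trans (sym (lookup∘tabulate (does ∘ P?) x)) ([]=⇒lookup x∈)
  ... | yes px | _ = px
  ... | no _   | ()

preimage : (Fin m → Fin n) → Fin n → Subset m
preimage f r = sift (λ x → f x ≟ r)

module _ (f : Fin m → Fin n) {r : Fin n} {x : Fin m} where

  ∈-preimage⁺ : f x ≡ r → x ∈ preimage f r
  ∈-preimage⁺ = ∈-sift⁺ (λ x → f x ≟ r)

  ∈-preimage⁻ : x ∈ preimage f r → f x ≡ r
  ∈-preimage⁻ = ∈-sift⁻ (λ x → f x ≟ r)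

x∈p-y⁻ : ∀ {p : Subset n} {x y} → x ∈ p - y → x ∈ p × x ≢ y
x∈p-y⁻ {p = p} {x} {y} x∈p-y = p─q⊆p p ⁅ y ⁆ x∈p-y , λ { refl → x∉p-x x∈p-y }
  where
  x∉p-x : ∀ {n} {p : Subset n} {x} → x ∉ p - x
  x∉p-x {p = _ ∷ _} {zero}  ()
  x∉p-x {p = _ ∷ p} {suc x} (there x∈) = x∉p-x {p = p} x∈

∣p∣≡1+∣p-x∣ : ∀ {p : Subset n} {x} → x ∈ p → ∣ p ∣ ≡ suc ∣ p - x ∣
∣p∣≡1+∣p-x∣ {p = _ ∷ p} {zero} here = cong (suc ∘ ∣_∣) (sym (p─⊥≡p p))
∣p∣≡1+∣p-x∣ {p = outside ∷ p} (there x∈p) = ∣p∣≡1+∣p-x∣ x∈p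
∣p∣≡1+∣p-x∣ {p = inside  ∷ p} (there x∈p) = cong suc (∣p∣≡1+∣p-x∣ x∈p)

∣p∪⁅x⁆∣≡1+∣p∣ : ∀ {p : Subset n} {x} → x ∉ p → ∣ p ∪ ⁅ x ⁆ ∣ ≡ suc ∣ p ∣
∣p∪⁅x⁆∣≡1+∣p∣ {p = outside ∷ p} {zero}  x∉p = cong (suc ∘ ∣_∣) (∪-identityʳ p)
∣p∪⁅x⁆∣≡1+∣p∣ {p = inside  ∷ p} {zero}  x∉p = contradiction here x∉p
∣p∪⁅x⁆∣≡1+∣p∣ {p = outside ∷ p} {suc x} x∉p = ∣p∪⁅x⁆∣≡1+∣p∣ (x∉p ∘ there)
∣p∪⁅x⁆∣≡1+∣p∣ {p = inside  ∷ p} {suc x} x∉p = cong suc (∣p∪⁅x⁆∣≡1+∣p∣ (x∉p ∘ there))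

x∈p∪⁅y⁆⁻ : ∀ {p : Subset n} {x y} → x ∈ p ∪ ⁅ y ⁆ → x ∈ p ⊎ x ≡ y
x∈p∪⁅y⁆⁻ {p = p} {x} {y} x∈ with x∈p∪q⁻ p ⁅ y ⁆ x∈
... | inj₁ x∈p = inj₁ x∈p
... | inj₂ x∈y = inj₂ (x∈⁅y⁆⇒x≡y y x∈y)

y∈p∪⁅y⁆ : ∀ (p : Subset n) y → y ∈ p ∪ ⁅ y ⁆
y∈p∪⁅y⁆ p y = x∈p∪q⁺ (inj₂ (x∈⁅x⁆ y))

x∈p⇒1≤∣p∣ : ∀ {p : Subset n} {x} → x ∈ p → 1 ℕ.≤ ∣ p ∣
x∈p⇒1≤∣p∣ x∈p = subst (1 ℕ.≤_) (sym (∣p∣≡1+∣p-x∣ x∈p)) (s≤s z≤n)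

x≢y∈p⇒2≤∣p∣ : ∀ {p : Subset n} {x y} → x ∈ p → y ∈ p → x ≢ y → 2 ℕ.≤ ∣ p ∣
x≢y∈p⇒2≤∣p∣ x∈p y∈p x≢y = subst (2 ℕ.≤_) (sym (∣p∣≡1+∣p-x∣ y∈p))
  (s≤s (x∈p⇒1≤∣p∣ (x∈p∧x≢y⇒x∈p-y x∈p x≢y)))

1≤∣p∣⇒Nonempty : ∀ {p : Subset n} → 1 ℕ.≤ ∣ p ∣ → Subset.Nonempty p
1≤∣p∣⇒Nonempty {n} {p} 1≤∣p∣ with nonempty? p
... | yes ne = ne
... | no ¬ne = contradiction (subst (1 ℕ.≤_)
  (trans (cong ∣_∣ (Empty-unique ¬ne)) (∣⊥∣≡0 n)) 1≤∣p∣) λ ()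

-- Indicator function: it turns a cardinality into a sum over all of `Fin n`, which can be compared
-- termwise with a sum of degrees.
χ : Subset n → Fin n → ℕ
χ p x = if lookup p x then 1 else 0

χ-∈ : ∀ {p : Subset n} {x} → x ∈ p → χ p x ≡ 1
χ-∈ x∈p = cong (if_then 1 else 0) ([]=⇒lookup x∈p)

χ-∉ : ∀ {p : Subset n} {x} → x ∉ p → χ p x ≡ 0
χ-∉ {p = p} {x} x∉p with lookup p x in eq
... | true  = contradiction (lookup⇒[]= x p eq) x∉p
... | false = refl

sum-χ : (p : Subset n) → ℕΣ.sum (χ p) ≡ ∣ p ∣
sum-χ []            = refl
sum-χ (inside  ∷ p) = cong suc (sum-χ p)
sum-χ (outside ∷ p) = sum-χ p

sum-χ-singleton : (x : Fin n) → ℕΣ.sum (λ r → if does (x ≟ r) then 1 else 0) ≡ 1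
sum-χ-singleton {suc n} zero    = cong suc (ℕΣ.sum-replicate-zero n)
sum-χ-singleton         (suc x) = sum-χ-singleton x

-- Induction along the subset: an element at the head adds 1 to exactly one summand, the one at
-- `f zero`. Both the handshake lemma and the additivity of `Δ` over components rest on this.
∣∣-partition : (f : Fin m → Fin n) (p : Subset m) →
  ∣ p ∣ ≡ ℕΣ.sum (λ r → ∣ p ∩ preimage f r ∣)
∣∣-partition {n = n} f []           = sym (ℕΣ.sum-replicate-zero n)
∣∣-partition f (outside ∷ p) = ∣∣-partition (f ∘ suc) p
∣∣-partition f (inside  ∷ p) = begin
  suc ∣ p ∣
    ≡⟨ cong₂ _+_ (sym (sum-χ-singleton (f zero))) (∣∣-partition (f ∘ suc) p) ⟩
  ℕΣ.sum here? + ℕΣ.sum (λ r → ∣ p ∩ preimage (f ∘ suc) r ∣)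
    ≡⟨ sym (ℕΣ.∑-distrib-+ here? _) ⟩
  ℕΣ.sum (λ r → here? r + ∣ p ∩ preimage (f ∘ suc) r ∣)
    ≡⟨ ℕΣ.sum-cong-≗ split ⟩
  ℕΣ.sum (λ r → ∣ (inside ∷ p) ∩ preimage f r ∣) ∎
  where
  open ≡-Reasoning
  here? : Fin _ → ℕ
  here? r = if does (f zero ≟ r) then 1 else 0
  split : ∀ r → here? r + ∣ p ∩ preimage (f ∘ suc) r ∣ ≡ ∣ (inside ∷ p) ∩ preimage f r ∣
  split r with does (f zero ≟ r)
  ... | true  = refl
  ... | false = refl

≐⇒≡ : ∀ {n} {p q : Subset n} {P : Fin n → Set} →
  (∀ x → x ∈ p ⇔ P x) → (∀ x → x ∈ q ⇔ P x) → p ≡ q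
≐⇒≡ p⇔ q⇔ = Subset.⊆-antisym
  (λ {x} x∈p → from (q⇔ x) (to (p⇔ x) x∈p)) (λ {x} x∈q → from (p⇔ x) (to (q⇔ x) x∈q))
  where open Equivalence

-- Inclusion and incidence in a fixed graph

module _ (G : Graph) where
  open Graph G

  infix 4 _∋_

  _∋_ : Fin #E → Fin #V → Set
  _∋_ = Incident {G}

  private variable
    X Y Z A B K T : Subgraph G
    u v w r : Fin #V
    e e′ : Fin #E

  ⊆-refl : X ⊆ X
  ⊆-refl = id , id

  ⊆-trans : X ⊆ Y → Y ⊆ Z → X ⊆ Z
  ⊆-trans (V , E) (V′ , E′) = V′ ∘ V , E′ ∘ E

  ⊆-antisym : X ⊆ Y → Y ⊆ X → X ≈ Y
  ⊆-antisym (V , E) (V′ , E′) = Subset.⊆-antisym V V′ , Subset.⊆-antisym E E′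

  ≈-sym : X ≈ Y → Y ≈ X
  ≈-sym (V , E) = sym V , sym E

  ≈-trans : X ≈ Y → Y ≈ Z → X ≈ Z
  ≈-trans (V , E) (V′ , E′) = trans V V′ , trans E E′

  ≈⇒⊆ : X ≈ Y → X ⊆ Y
  ≈⇒⊆ (V , E) = subst (_ ∈_) V , subst (_ ∈_) E

  ≈⇒⊇ : X ≈ Y → Y ⊆ X
  ≈⇒⊇ {X} {Y} X≈Y = ≈⇒⊆ {Y} {X} (≈-sym {X} {Y} X≈Y)

  Δ-cong : X ≈ Y → Δ X ≡ Δ Y
  Δ-cong (V , E) = cong₂ _⊖_ (cong ∣_∣ E) (cong ∣_∣ V)

  Ends : Fin #E → Fin #V → Fin #V → Set
  Ends e u v = (end₁ e ≡ u × end₂ e ≡ v) ⊎ (end₁ e ≡ v × end₂ e ≡ u)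

  _∋?_ : ∀ e v → Dec (e ∋ v)
  e ∋? v = (end₁ e ≟ v) ⊎-dec (end₂ e ≟ v)

  Incident⇒Ends : e ∋ v → ∃ (Ends e v)
  Incident⇒Ends (inj₁ p) = _ , inj₁ (p , refl)
  Incident⇒Ends (inj₂ p) = _ , inj₂ (refl , p)

  Ends⇒Incident : Ends e u v → e ∋ u
  Ends⇒Incident = [ inj₁ ∘ proj₁ , inj₂ ∘ proj₂ ]′

  Incident-Ends : e ∋ w → Ends e u v → w ≡ u ⊎ w ≡ v
  Incident-Ends (inj₁ refl) (inj₁ (p , _)) = inj₁ p
  Incident-Ends (inj₁ refl) (inj₂ (p , _)) = inj₂ p
  Incident-Ends (inj₂ refl) (inj₁ (_ , p)) = inj₂ p
  Incident-Ends (inj₂ refl) (inj₂ (_ , p)) = inj₁ p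

  incident-∈ : (X : Subgraph G) → e ∈ edges X → e ∋ v → v ∈ vertices X
  incident-∈ X e∈X (inj₁ refl) = proj₁ (closed X e∈X)
  incident-∈ X e∈X (inj₂ refl) = proj₂ (closed X e∈X)

  Adjacent-sym : Adjacent X u v → Adjacent X v u
  Adjacent-sym (e , e∈X , ends) = e , e∈X , swap ends

  Adjacent-mono : X ⊆ Y → Adjacent X u v → Adjacent Y u v
  Adjacent-mono X⊆Y (e , e∈X , ends) = e , proj₂ X⊆Y e∈X , ends

  edge-Adjacent : e ∈ edges X → Adjacent X (end₁ e) (end₂ e)
  edge-Adjacent e∈X = _ , e∈X , inj₁ (refl , refl)

  -- Colourings constant on the components of a subgraph

  record Colouring (X : Subgraph G) : Set where
    field
      colour   : Fin #V → Fin #V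
      respects : ∀ {e} → e ∈ edges X → colour (end₁ e) ≡ colour (end₂ e)

    respects-Incident : e ∈ edges X → e ∋ v → colour (end₁ e) ≡ colour v
    respects-Incident e∈X (inj₁ refl) = refl
    respects-Incident e∈X (inj₂ refl) = respects e∈X

    respects-Adjacent : Adjacent X u v → colour u ≡ colour v
    respects-Adjacent (e , e∈X , ends) = trans
      (sym (respects-Incident e∈X (Ends⇒Incident ends)))
      (respects-Incident e∈X (Ends⇒Incident (swap ends)))

    respects-Star : Star (Adjacent X) u v → colour u ≡ colour v
    respects-Star ε        = refl
    respects-Star (a ◅ as) = trans (respects-Adjacent a) (respects-Star as)

    class : Fin #V → Subgraph G
    class r = record
      { vertices = vertices X ∩ preimage colour r
      ; edges    = edges X ∩ preimage (colour ∘ end₁) r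
      ; closed   = λ e∈ → let (e∈X , e∈r) = x∈p∩q⁻ (edges X) _ e∈
                              c≡r = ∈-preimage⁻ (colour ∘ end₁) e∈r in
          x∈p∩q⁺ (proj₁ (closed X e∈X) , ∈-preimage⁺ colour c≡r)
        , x∈p∩q⁺ (proj₂ (closed X e∈X) , ∈-preimage⁺ colour (trans (sym (respects e∈X)) c≡r))
      }

    ∈-class⁺ : v ∈ vertices X → colour v ≡ r → v ∈ vertices (class r)
    ∈-class⁺ v∈X c≡r = x∈p∩q⁺ (v∈X , ∈-preimage⁺ colour c≡r)

    ∈-class⁻ : v ∈ vertices (class r) → v ∈ vertices X × colour v ≡ r
    ∈-class⁻ v∈ = map₂ (∈-preimage⁻ colour) (x∈p∩q⁻ (vertices X) _ v∈)

    edge-∈-class⁺ : e ∈ edges X → e ∋ v → colour v ≡ r → e ∈ edges (class r)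
    edge-∈-class⁺ e∈X inc c≡r = x∈p∩q⁺
      (e∈X , ∈-preimage⁺ (colour ∘ end₁) (trans (respects-Incident e∈X inc) c≡r))

    edge-∈-class⁻ : e ∈ edges (class r) → e ∈ edges X × colour (end₁ e) ≡ r
    edge-∈-class⁻ e∈ = map₂ (∈-preimage⁻ (colour ∘ end₁)) (x∈p∩q⁻ (edges X) _ e∈)

    class-⊆ : class r ⊆ X
    class-⊆ = proj₁ ∘ ∈-class⁻ , proj₁ ∘ edge-∈-class⁻

    Δ-classes : Δ X ≡ ℤΣ.sum (Δ ∘ class)
    Δ-classes = trans
      (cong₂ _⊖_ (∣∣-partition (colour ∘ end₁) (edges X)) (∣∣-partition colour (vertices X)))
      (sym (sum-⊖ (∣_∣ ∘ edges ∘ class) (∣_∣ ∘ vertices ∘ class)))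

    class-NoLeaves : NoLeaves X → NoLeaves (class r)
    class-NoLeaves nl v (e , v∈ , e∈ , inc , ¬loop , uniq) = nl v
      (e , proj₁ (∈-class⁻ v∈) , proj₁ (edge-∈-class⁻ e∈) , inc , ¬loop ,
       λ e′∈X inc′ → uniq (edge-∈-class⁺ e′∈X inc′ (proj₂ (∈-class⁻ v∈))) inc′)

    class-NoIsolated : NoIsolated X → NoIsolated (class r)
    class-NoIsolated ni v∈ =
      let (v∈X , c≡r) = ∈-class⁻ v∈
          (e , e∈X , inc) = ni v∈X
      in e , edge-∈-class⁺ e∈X inc c≡r , inc

    connected-⊆-class : B ⊆ X → Connected B → v ∈ vertices B → B ⊆ class (colour v)
    connected-⊆-class {B} {v} B⊆X (_ , walk) v∈B = V , E
      where
      same : u ∈ vertices B → colour u ≡ colour v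
      same u∈B = respects-Star (Star-map (Adjacent-mono {X = B} {Y = X} B⊆X) (walk u∈B v∈B))
      V : vertices B Subset.⊆ vertices (class (colour v))
      V u∈B = ∈-class⁺ (proj₁ B⊆X u∈B) (same u∈B)
      E : edges B Subset.⊆ edges (class (colour v))
      E e∈B = edge-∈-class⁺ (proj₂ B⊆X e∈B) (inj₁ refl) (same (proj₁ (closed B e∈B)))

  restrict : Colouring Y → X ⊆ Y → Colouring X
  restrict c X⊆Y = record { colour = colour ; respects = respects ∘ proj₂ X⊆Y }
    where open Colouring c

  -- With the converse condition `connects`, the nonempty classes are exactly the components of `X`.
  -- The condition also covers vertices outside `X`; each of them therefore has a colour of its own.
  record ComponentColouring (X : Subgraph G) : Set where
    field
      colouring : Colouring X
    open Colouring colouring public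
    field
      connects : ∀ u v → colour u ≡ colour v → Star (Adjacent X) u v

    class-connected : v ∈ vertices X → Connected (class (colour v))
    class-connected {v} v∈X = (v , ∈-class⁺ v∈X refl) , λ u∈ w∈ →
      let cu = proj₂ (∈-class⁻ u∈) ; cw = proj₂ (∈-class⁻ w∈)
      in lift (connects _ _ (trans cu (sym cw))) cu
      where
      -- A walk never changes colour, so it stays inside the class of its start.
      lift : Star (Adjacent X) u w → colour u ≡ r → Star (Adjacent (class r)) u w
      lift ε _ = ε
      lift (a@(e , e∈X , ends) ◅ as) cu =
        (e , edge-∈-class⁺ e∈X (Ends⇒Incident ends) cu , ends) ◅
        lift as (trans (sym (respects-Adjacent a)) cu)

    class-IsComponent : v ∈ vertices X → IsComponent X (class (colour v))
    class-IsComponent {v} v∈X = class-⊆ , class-connected v∈X ,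
      λ B B⊆X conn A⊆B → connected-⊆-class {B} B⊆X conn (proj₁ A⊆B (∈-class⁺ v∈X refl))

    component-≈-class : IsComponent X A → v ∈ vertices A → A ≈ class (colour v)
    component-≈-class {A} {v} (A⊆X , conn , max) v∈A =
      ⊆-antisym {A} {C} A⊆C (max C class-⊆ (class-connected (proj₁ A⊆X v∈A)) A⊆C)
      where
      C   = class (colour v)
      A⊆C = connected-⊆-class {A} A⊆X conn v∈A

  -- Union-find: all vertices start with different colours, and each edge of `X` in turn recolours
  -- the class of its first end with the colour of its second end.
  componentColouring : (X : Subgraph G) → ComponentColouring X
  componentColouring X =
    let (colour , respects , connects) = merge (allFin #E) in record
    { colouring = record
      { colour = colour ; respects = λ {e} e∈X → respects (∈-allFin e) e∈X }
    ; connects  = connects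
    }
    where
    merge : (es : List (Fin #E)) → ∃ λ (c : Fin #V → Fin #V) →
      (∀ {e} → e ∈ˡ es → e ∈ edges X → c (end₁ e) ≡ c (end₂ e)) ×
      (∀ u v → c u ≡ c v → Star (Adjacent X) u v)
    merge [] = id , (λ ()) , λ { u v refl → ε }
    merge (e ∷ es) with merge es | e ∈? edges X
    ... | c , res , conn | no e∉X =
      c , (λ { (hereˡ refl) e∈X → contradiction e∈X e∉X ; (thereˡ p) → res p }) , conn
    ... | c , res , conn | yes e∈X = recolour ∘ c , res′ , conn′
      where
      recolour : Fin #V → Fin #V
      recolour x with x ≟ c (end₁ e)
      ... | yes _ = c (end₂ e)
      ... | no _  = x

      recolour-end : ∀ x → x ≡ c (end₁ e) ⊎ x ≡ c (end₂ e) → recolour x ≡ c (end₂ e)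
      recolour-end x p with x ≟ c (end₁ e)
      ... | yes _ = refl
      ... | no x≢ = [ (λ q → contradiction q x≢) , id ]′ p

      res′ : ∀ {e′} → e′ ∈ˡ (e ∷ es) → e′ ∈ edges X →
        recolour (c (end₁ e′)) ≡ recolour (c (end₂ e′))
      res′ (hereˡ refl) _ = trans (recolour-end _ (inj₁ refl)) (sym (recolour-end _ (inj₂ refl)))
      res′ (thereˡ p) e′∈X = cong recolour (res p e′∈X)

      conn′ : ∀ u v → recolour (c u) ≡ recolour (c v) → Star (Adjacent X) u v
      conn′ u v eq with c u ≟ c (end₁ e) | c v ≟ c (end₁ e)
      ... | yes p | yes q = conn u v (trans p (sym q))
      -- Here `u` has just been recoloured and `v` has not: walk from `u` to the first end of `e`,
      -- cross `e`, and go on to `v`.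
      ... | yes p | no _  = conn u _ p ◅◅ edge-Adjacent {X = X} e∈X ◅ conn _ v eq
      ... | no _  | yes q = conn u _ eq ◅◅
        Adjacent-sym {X = X} (edge-Adjacent {X = X} e∈X) ◅ conn _ v (sym q)
      ... | no _  | no _  = conn u v eq

  -- Pruning

  leafWithEdge? : ∀ X v e → Dec (LeafWithEdge {G} X v e)
  leafWithEdge? X v e = v ∈? vertices X ×-dec e ∈? edges X ×-dec e ∋? v ×-dec
    ¬? (end₁ e ≟ end₂ e) ×-dec
    map′ (λ f {e′} → f e′) (λ f e′ → f {e′})
      (all? λ e′ → e′ ∈? edges X →-dec (e′ ∋? v →-dec e′ ≟ e))

  remove-leaf : LeafWithEdge X v e → ∃ λ K → X ⇝ K
  remove-leaf {X} {v} {e} leaf@(_ , _ , _ , _ , uniq) =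
    record
    { vertices = vertices X - v
    ; edges    = edges X - e
    ; closed   = λ e′∈ → let (e′∈X , e′≢e) = x∈p-y⁻ e′∈ in
          x∈p∧x≢y⇒x∈p-y (proj₁ (closed X e′∈X)) (e′≢e ∘ uniq e′∈X ∘ inj₁)
        , x∈p∧x≢y⇒x∈p-y (proj₂ (closed X e′∈X)) (e′≢e ∘ uniq e′∈X ∘ inj₂)
    } , v , e , leaf , refl , refl

  ⇝-∣vertices∣ : X ⇝ K → ∣ vertices X ∣ ≡ suc ∣ vertices K ∣
  ⇝-∣vertices∣ (_ , _ , (v∈X , _) , V , _) = trans (∣p∣≡1+∣p-x∣ v∈X) (cong (suc ∘ ∣_∣) (sym V))

  ⇝-∣edges∣ : X ⇝ K → ∣ edges X ∣ ≡ suc ∣ edges K ∣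
  ⇝-∣edges∣ (_ , _ , (_ , e∈X , _) , _ , E) = trans (∣p∣≡1+∣p-x∣ e∈X) (cong (suc ∘ ∣_∣) (sym E))

  -- The first argument of `go` bounds the number of edges, and each deletion removes exactly one.
  prune : ∀ X → ∃ (IsKernel {G} X)
  prune X = go _ X ℕ.≤-refl
    where
    go : ∀ n X → ∣ edges X ∣ ℕ.≤ n → ∃ (IsKernel {G} X)
    go n X ∣X∣≤n with any? (λ v → any? (leafWithEdge? X v))
    ... | no ¬leaf = X , ε , λ v leaf → ¬leaf (v , leaf)
    ... | yes (v , e , leaf) with remove-leaf {X} leaf
    go zero X ∣X∣≤n | yes _ | K , X⇝K =
      contradiction (subst (ℕ._≤ 0) (⇝-∣edges∣ {X} {K} X⇝K) ∣X∣≤n) λ ()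
    go (suc n) X ∣X∣≤n | yes _ | K , X⇝K =
      let (L , K⇝*L , nl) = go n K (ℕ.≤-pred (subst (ℕ._≤ suc n) (⇝-∣edges∣ {X} {K} X⇝K) ∣X∣≤n))
      in L , X⇝K ◅ K⇝*L , nl

  ⇝-⊆ : X ⇝ K → K ⊆ X
  ⇝-⊆ (v , e , _ , V , E) =
    (λ x∈ → proj₁ (x∈p-y⁻ (subst (_ ∈_) V x∈))) , (λ x∈ → proj₁ (x∈p-y⁻ (subst (_ ∈_) E x∈)))

  ⇝-Δ : X ⇝ K → Δ X ≡ Δ K
  ⇝-Δ {X} {K} X⇝K = trans
    (cong₂ _⊖_ (⇝-∣edges∣ {X} {K} X⇝K) (⇝-∣vertices∣ {X} {K} X⇝K))
    (ℤ.[1+m]⊖[1+n]≡m⊖n ∣ edges K ∣ ∣ vertices K ∣)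

  -- A walk is pushed off the deleted leaf v by moving each visit of v to its neighbour x.
  ⇝-Connected : X ⇝ K → Connected X → Connected K
  ⇝-Connected {X} {K} (v , e , (v∈X , e∈X , inc , ¬loop , uniq) , V , E) (_ , walk) =
    (x , ∈K (incident-∈ X e∈X (Ends⇒Incident (swap ends))) x≢v) ,
    λ u∈K w∈K → subst₂ (Star (Adjacent K)) (push-≢ (≢v u∈K)) (push-≢ (≢v w∈K))
      (kleisliStar push push-Adjacent (walk (∈X u∈K) (∈X w∈K)))
    where
    ∈X : u ∈ vertices K → u ∈ vertices X
    ∈X = proj₁ (⇝-⊆ {X} {K} (v , e , (v∈X , e∈X , inc , ¬loop , uniq) , V , E))

    x    = proj₁ (Incident⇒Ends inc)
    ends = proj₂ (Incident⇒Ends inc)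

    x≢v : x ≢ v
    x≢v x≡v = ¬loop (loop ends)
      where
      loop : Ends e v x → end₁ e ≡ end₂ e
      loop (inj₁ (p , q)) = trans p (sym (trans q x≡v))
      loop (inj₂ (p , q)) = trans p (trans x≡v (sym q))

    ∈K : u ∈ vertices X → u ≢ v → u ∈ vertices K
    ∈K u∈X u≢v = subst (_ ∈_) (sym V) (x∈p∧x≢y⇒x∈p-y u∈X u≢v)

    ≢v : u ∈ vertices K → u ≢ v
    ≢v u∈K = proj₂ (x∈p-y⁻ (subst (_ ∈_) V u∈K))

    push : Fin #V → Fin #V
    push u with u ≟ v
    ... | yes _ = x
    ... | no  _ = u

    push-≢ : u ≢ v → push u ≡ u
    push-≢ {u} u≢v with u ≟ v
    ... | yes u≡v = contradiction u≡v u≢v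
    ... | no _    = refl

    push-end : e ∋ u → push u ≡ x
    push-end {u} inc′ with u ≟ v
    ... | yes _   = refl
    ... | no u≢v = [ (λ u≡v → contradiction u≡v u≢v) , id ]′ (Incident-Ends inc′ ends)

    push-Adjacent : Adjacent X u w → Star (Adjacent K) (push u) (push w)
    push-Adjacent {u} {w} (e′ , e′∈X , ends′) with e′ ≟ e
    -- Both ends of `e` are pushed to `x`, so a step along `e` disappears. Every other edge avoids
    -- `v`, because `e` is the only edge there, and survives unchanged.
    ... | yes refl = subst (Star (Adjacent K) (push u))
      (trans (push-end (Ends⇒Incident ends′)) (sym (push-end (Ends⇒Incident (swap ends′))))) ε
    ... | no e′≢e = subst₂ (Star (Adjacent K))
      (sym (push-≢ (avoid (Ends⇒Incident ends′))))
      (sym (push-≢ (avoid (Ends⇒Incident (swap ends′)))))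
      ((e′ , subst (_ ∈_) (sym E) (x∈p∧x≢y⇒x∈p-y e′∈X e′≢e) , ends′) ◅ ε)
      where
      avoid : ∀ {u} → e′ ∋ u → u ≢ v
      avoid inc′ refl = e′≢e (uniq e′∈X inc′)

  -- If `B` contained the deleted leaf `v`, the edge of `B` at `v` could only be `e`, and `v` would
  -- be a leaf of `B` as well.
  ⇝-preserves-leafless : NoIsolated B → NoLeaves B → X ⇝ K → B ⊆ X → B ⊆ K
  ⇝-preserves-leafless {B} {X} {K} ni nl (v , e , (_ , _ , inc , ¬loop , uniq) , V , E) (V⊆ , E⊆) =
    (λ u∈B → subst (_ ∈_) (sym V) (x∈p∧x≢y⇒x∈p-y (V⊆ u∈B) (λ { refl → v∉B u∈B }))) ,
    (λ e′∈B → subst (_ ∈_) (sym E) (x∈p∧x≢y⇒x∈p-y (E⊆ e′∈B)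
      (λ { refl → v∉B (incident-∈ B e′∈B inc) })))
    where
    v∉B : v ∉ vertices B
    v∉B v∈B = let (e′ , e′∈B , inc′) = ni v∈B in nl v
      (e , v∈B , subst (_∈ edges B) (uniq (E⊆ e′∈B) inc′) e′∈B , inc , ¬loop , uniq ∘ E⊆)

  ⇝*-⊆ : Star _⇝_ X K → K ⊆ X
  ⇝*-⊆ {X} ε = ⊆-refl {X}
  ⇝*-⊆ {X} {K} (_◅_ {j = Y} s ss) = ⊆-trans {K} {Y} {X} (⇝*-⊆ ss) (⇝-⊆ {X} {Y} s)

  ⇝*-Δ : Star _⇝_ X K → Δ X ≡ Δ K
  ⇝*-Δ ε = refl
  ⇝*-Δ {X} (_◅_ {j = Y} s ss) = trans (⇝-Δ {X} {Y} s) (⇝*-Δ ss)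

  ⇝*-Connected : Star _⇝_ X K → Connected X → Connected K
  ⇝*-Connected ε = id
  ⇝*-Connected {X} (_◅_ {j = Y} s ss) = ⇝*-Connected ss ∘ ⇝-Connected {X} {Y} s

  ⇝*-preserves-leafless : NoIsolated B → NoLeaves B → Star _⇝_ X K → B ⊆ X → B ⊆ K
  ⇝*-preserves-leafless ni nl ε = id
  ⇝*-preserves-leafless {B} {X} ni nl (_◅_ {j = Y} s ss) =
    ⇝*-preserves-leafless {B} ni nl ss ∘ ⇝-preserves-leafless {B} {X} {Y} ni nl s

  -- Degrees

  -- Counting the edges by their first end and again by their second end counts each edge twice.
  handshake : (X : Subgraph G) → ℕΣ.sum (degree X) ≡ ∣ edges X ∣ + ∣ edges X ∣
  handshake X = trans
    (ℕΣ.∑-distrib-+ (λ v → ∣ edges X ∩ preimage end₁ v ∣) (λ v → ∣ edges X ∩ preimage end₂ v ∣))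
    (sym (cong₂ _+_ (∣∣-partition end₁ (edges X)) (∣∣-partition end₂ (edges X))))

  -- The degree function that `X` would have if all its degrees were 2. Against `degree` it turns
  -- the handshake lemma into a comparison of |V| with |E|.
  twice : Subgraph G → Fin #V → ℕ
  twice X v = χ (vertices X) v + χ (vertices X) v

  sum-twice : (X : Subgraph G) → ℕΣ.sum (twice X) ≡ ∣ vertices X ∣ + ∣ vertices X ∣
  sum-twice X = trans (ℕΣ.∑-distrib-+ (χ (vertices X)) (χ (vertices X)))
    (cong₂ _+_ (sum-χ (vertices X)) (sum-χ (vertices X)))

  twice-∈ : v ∈ vertices X → twice X v ≡ 2
  twice-∈ v∈X = cong₂ _+_ (χ-∈ v∈X) (χ-∈ v∈X)

  twice-∉ : v ∉ vertices X → twice X v ≡ 0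
  twice-∉ v∉X = cong₂ _+_ (χ-∉ v∉X) (χ-∉ v∉X)

  degree-∉ : v ∉ vertices X → degree X v ≡ 0
  degree-∉ {v} {X} v∉X = cong₂ _+_
    (empty end₁ λ e∈X p → v∉X (incident-∈ X e∈X (inj₁ p)))
    (empty end₂ λ e∈X p → v∉X (incident-∈ X e∈X (inj₂ p)))
    where
    empty : (end : Fin #E → Fin #V) → (∀ {e} → e ∈ edges X → end e ≢ v) →
      ∣ edges X ∩ preimage end v ∣ ≡ 0
    empty end end≢v = ℕ.n<1⇒n≡0 (ℕ.≰⇒> λ 1≤ →
      let (e , e∈) = 1≤∣p∣⇒Nonempty 1≤
          (e∈X , e∈v) = x∈p∩q⁻ (edges X) _ e∈
      in end≢v e∈X (∈-preimage⁻ end e∈v))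

  -- Some edge meets `v`. If it is a loop, it counts at both ends; otherwise a second edge meets
  -- `v`, as `v` is not a leaf.
  leafless⇒2≤degree : NoIsolated X → NoLeaves X → v ∈ vertices X → 2 ℕ.≤ degree X v
  leafless⇒2≤degree {X} {v} ni nl v∈X with ni v∈X
  ... | e , e∈X , inc with end₁ e ≟ end₂ e
  ... | yes loop = ℕ.+-mono-≤
    (x∈p⇒1≤∣p∣ (∈fibre end₁ (proj₁ both))) (x∈p⇒1≤∣p∣ (∈fibre end₂ (proj₂ both)))
    where
    ∈fibre : (end : Fin #E → Fin #V) → end e ≡ v → e ∈ edges X ∩ preimage end v
    ∈fibre end p = x∈p∩q⁺ (e∈X , ∈-preimage⁺ end p)
    both : end₁ e ≡ v × end₂ e ≡ v
    both = [ (λ p → p , trans (sym loop) p) , (λ p → trans loop p , p) ]′ inc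
  ... | no ¬loop with any? (λ e′ → e′ ∈? edges X ×-dec e′ ∋? v ×-dec ¬? (e′ ≟ e))
  ... | no ¬other = contradiction
    (e , v∈X , e∈X , inc , ¬loop ,
     λ {e′} e′∈X inc′ → decidable-stable (e′ ≟ e) (λ e′≢e → ¬other (e′ , e′∈X , inc′ , e′≢e)))
    (nl v)
  ... | yes (e′ , e′∈X , inc′ , e′≢e) = count inc′ inc
    where
    e∈fibre : (end : Fin #E → Fin #V) → end e ≡ v → e ∈ edges X ∩ preimage end v
    e∈fibre end p = x∈p∩q⁺ (e∈X , ∈-preimage⁺ end p)
    e′∈fibre : (end : Fin #E → Fin #V) → end e′ ≡ v → e′ ∈ edges X ∩ preimage end v
    e′∈fibre end p = x∈p∩q⁺ (e′∈X , ∈-preimage⁺ end p)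
    count : e′ ∋ v → e ∋ v → 2 ℕ.≤ degree X v
    count (inj₁ p) (inj₁ q) =
      ℕ.m≤n⇒m≤n+o _ (x≢y∈p⇒2≤∣p∣ (e′∈fibre end₁ p) (e∈fibre end₁ q) e′≢e)
    count (inj₁ p) (inj₂ q) =
      ℕ.+-mono-≤ (x∈p⇒1≤∣p∣ (e′∈fibre end₁ p)) (x∈p⇒1≤∣p∣ (e∈fibre end₂ q))
    count (inj₂ p) (inj₁ q) =
      ℕ.+-mono-≤ (x∈p⇒1≤∣p∣ (e∈fibre end₁ q)) (x∈p⇒1≤∣p∣ (e′∈fibre end₂ p))
    count (inj₂ p) (inj₂ q) =
      ℕ.m≤n⇒m≤o+n _ (x≢y∈p⇒2≤∣p∣ (e′∈fibre end₂ p) (e∈fibre end₂ q) e′≢e)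

  -- All degrees are at least 2, so a single larger one pushes their sum 2|E| above 2|V|.
  leafless⇒degrees≡2⊎∣V∣<∣E∣ : NoIsolated X → NoLeaves X →
    (∀ {v} → v ∈ vertices X → degree X v ≡ 2) ⊎ ∣ vertices X ∣ ℕ.< ∣ edges X ∣
  leafless⇒degrees≡2⊎∣V∣<∣E∣ {X} ni nl
    with any? (λ v → v ∈? vertices X ×-dec ¬? (degree X v ℕ.≟ 2))
  ... | no ¬∃ = inj₁ λ {v} v∈X →
    decidable-stable (degree X v ℕ.≟ 2) λ d≢2 → ¬∃ (v , v∈X , d≢2)
  ... | yes (v , v∈X , d≢2) = inj₂ (m+m<n+n⇒m<n (subst₂ ℕ._<_ (sum-twice X) (handshake X)
    (ℕ-MonotoneSum.sum-mono-< twice≤degree v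
      (subst (ℕ._< degree X v) (sym (twice-∈ {X = X} v∈X))
        (ℕ.≤∧≢⇒< (leafless⇒2≤degree {X} ni nl v∈X) (d≢2 ∘ sym))))))
    where
    twice≤degree : ∀ u → twice X u ℕ.≤ degree X u
    twice≤degree u with u ∈? vertices X
    ... | yes u∈X = subst (ℕ._≤ degree X u) (sym (twice-∈ {X = X} u∈X))
      (leafless⇒2≤degree {X} ni nl u∈X)
    ... | no  u∉X = subst (ℕ._≤ degree X u) (sym (twice-∉ {X = X} u∉X)) z≤n

  cycle-Δ : IsCycle X → Δ X ≡ + 0
  cycle-Δ {X} (_ , deg≡2) = trans (cong (_⊖ ∣ vertices X ∣) ∣E∣≡∣V∣) (ℤ.n⊖n≡0 ∣ vertices X ∣)
    where
    degree≡twice : ∀ v → degree X v ≡ twice X v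
    degree≡twice v with v ∈? vertices X
    ... | yes v∈X = trans (deg≡2 v∈X) (sym (twice-∈ {X = X} v∈X))
    ... | no  v∉X = trans (degree-∉ {X = X} v∉X) (sym (twice-∉ {X = X} v∉X))
    2∣E∣≡2∣V∣ : ∣ edges X ∣ + ∣ edges X ∣ ≡ ∣ vertices X ∣ + ∣ vertices X ∣
    2∣E∣≡2∣V∣ = trans (sym (handshake X)) (trans (ℕΣ.sum-cong-≗ degree≡twice) (sum-twice X))
    ∣E∣≡∣V∣ : ∣ edges X ∣ ≡ ∣ vertices X ∣
    ∣E∣≡∣V∣ = ℕ.≤-antisym (m+m≤n+n⇒m≤n (ℕ.≤-reflexive 2∣E∣≡2∣V∣))
      (m+m≤n+n⇒m≤n (ℕ.≤-reflexive (sym 2∣E∣≡2∣V∣)))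

  -- Growing a subgraph of a connected graph

  -- The possible results of enlarging `X` to `A` edge by edge: nothing was added; some edge joined
  -- two old vertices and raised `Δ`; or every edge brought a new vertex, and the last such vertex
  -- is a leaf of `A`.
  Growth : Subgraph G → Subgraph G → Set
  Growth X A = X ≈ A ⊎ Δ X ℤ.< Δ A ⊎ (Δ X ≡ Δ A × ∃ (IsLeaf A))

  Growth⇒Δ≤ : Growth X A → Δ X ℤ.≤ Δ A
  Growth⇒Δ≤ {X} {A} (inj₁ X≈A)              = ℤ.≤-reflexive (Δ-cong {X} {A} X≈A)
  Growth⇒Δ≤ (inj₂ (inj₁ ΔX<ΔA))       = ℤ.<⇒≤ ΔX<ΔA
  Growth⇒Δ≤ (inj₂ (inj₂ (ΔX≡ΔA , _))) = ℤ.≤-reflexive ΔX≡ΔA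

  module _ {X A : Subgraph G} (conn : Connected A) (X⊆A : X ⊆ A)
    (ne : Subset.Nonempty (vertices X))
    (touching⇒∈ : ∀ {e u} → e ∈ edges A → e ∋ u → u ∈ vertices X → e ∈ edges X) where

    -- No edge of `A` leaves `X`, so a walk in `A` that starts in `X` stays there, and connectedness
    -- lets walks reach all of `A`.
    saturated⇒≈ : X ≈ A
    saturated⇒≈ = ⊆-antisym {X} {A} X⊆A (V , λ e∈A →
      touching⇒∈ e∈A (inj₁ refl) (V (proj₁ (closed A e∈A))))
      where
      spread : Star (Adjacent A) u v → u ∈ vertices X → v ∈ vertices X
      spread ε u∈X = u∈X
      spread ((e , e∈A , ends) ◅ as) u∈X = spread as (incident-∈ X
        (touching⇒∈ e∈A (Ends⇒Incident ends) u∈X) (Ends⇒Incident (swap ends)))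
      V : vertices A Subset.⊆ vertices X
      V v∈A = spread (proj₂ conn (proj₁ X⊆A (proj₂ ne)) v∈A) (proj₂ ne)

  attach : (X : Subgraph G) → Ends e u w → u ∈ vertices X → Subgraph G
  attach {e} {u} {w} X ends u∈X = record
    { vertices = vertices X ∪ ⁅ w ⁆
    ; edges    = edges X ∪ ⁅ e ⁆
    ; closed   = λ e′∈ → end∈ e′∈ (inj₁ refl) , end∈ e′∈ (inj₂ refl)
    }
    where
    end∈ : ∀ {e′ x} → e′ ∈ edges X ∪ ⁅ e ⁆ → e′ ∋ x → x ∈ vertices X ∪ ⁅ w ⁆
    end∈ e′∈ inc with x∈p∪⁅y⁆⁻ e′∈
    ... | inj₁ e′∈X = p⊆p∪q ⁅ w ⁆ (incident-∈ X e′∈X inc)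
    ... | inj₂ refl with Incident-Ends inc ends
    ...   | inj₁ refl = p⊆p∪q ⁅ w ⁆ u∈X
    ...   | inj₂ refl = y∈p∪⁅y⁆ (vertices X) w

  -- The first argument of `go` bounds the number of edges of `A` missing from `X`. The recursion
  -- treats the enlarged `X′` first; `conclude` then accounts for the edge just added.
  growth : Connected A → X ⊆ A → Subset.Nonempty (vertices X) → Growth X A
  growth {A} {X} conn X⊆A ne = go ∣ edges A ∣ X X⊆A ne (ℕ.m≤m+n _ _)
    where
    go : ∀ n X → X ⊆ A → Subset.Nonempty (vertices X) →
      ∣ edges A ∣ ℕ.≤ n + ∣ edges X ∣ → Growth X A
    go n X X⊆A ne ∣A∣≤ with any? (λ e → e ∈? edges A ×-dec ¬? (e ∈? edges X) ×-dec
      any? (λ u → e ∋? u ×-dec u ∈? vertices X))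
    ... | no ¬∃ = inj₁ (saturated⇒≈ {X} {A} conn X⊆A ne λ {e} {u} e∈A inc u∈X →
      decidable-stable (e ∈? edges X) λ e∉X → ¬∃ (e , e∈A , e∉X , u , inc , u∈X))
    ... | yes (e , e∈A , e∉X , u , inc , u∈X) = extend n ∣A∣≤
      where
      x    = proj₁ (Incident⇒Ends inc)
      ends = proj₂ (Incident⇒Ends inc)
      X′   = attach X ends u∈X

      x∈A : x ∈ vertices A
      x∈A = incident-∈ A e∈A (Ends⇒Incident (swap ends))

      X′⊆A : X′ ⊆ A
      X′⊆A = (λ y∈ → [ proj₁ X⊆A , (λ { refl → x∈A }) ]′ (x∈p∪⁅y⁆⁻ y∈))
           , (λ y∈ → [ proj₂ X⊆A , (λ { refl → e∈A }) ]′ (x∈p∪⁅y⁆⁻ y∈))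

      ∣X′∣ : ∣ edges X′ ∣ ≡ suc ∣ edges X ∣
      ∣X′∣ = ∣p∪⁅x⁆∣≡1+∣p∣ e∉X

      conclude : Growth X′ A → Growth X A
      conclude g with x ∈? vertices X
      ... | yes x∈X = inj₂ (inj₁ (ℤ.<-≤-trans ΔX<ΔX′ (Growth⇒Δ≤ {X′} {A} g)))
        where
        V : vertices X ∪ ⁅ x ⁆ ≡ vertices X
        V = Subset.⊆-antisym
          (λ y∈ → [ id , (λ { refl → x∈X }) ]′ (x∈p∪⁅y⁆⁻ y∈)) (p⊆p∪q ⁅ x ⁆)
        ΔX<ΔX′ : Δ X ℤ.< Δ X′
        ΔX<ΔX′ = subst (Δ X ℤ.<_) (sym (cong₂ _⊖_ ∣X′∣ (cong ∣_∣ V)))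
          (ℤ.⊖-monoˡ-< ∣ vertices X ∣ (ℕ.n<1+n ∣ edges X ∣))
      ... | no x∉X = new g
        where
        ΔX′≡ΔX : Δ X′ ≡ Δ X
        ΔX′≡ΔX = trans (cong₂ _⊖_ ∣X′∣ (∣p∪⁅x⁆∣≡1+∣p∣ x∉X))
          (ℤ.[1+m]⊖[1+n]≡m⊖n ∣ edges X ∣ ∣ vertices X ∣)

        ¬loop : Ends e u x → end₁ e ≢ end₂ e
        ¬loop (inj₁ (p , q)) loop =
          x∉X (subst (_∈ vertices X) (trans (sym p) (trans loop q)) u∈X)
        ¬loop (inj₂ (p , q)) loop =
          x∉X (subst (_∈ vertices X) (trans (sym q) (trans (sym loop) p)) u∈X)

        new : Growth X′ A → Growth X A
        -- The edge `e` was the last one missing. Since `x` is not in `X`, no edge of `X` meets it,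
        -- so `e` is its only edge in `A`.
        new (inj₁ X′≈A) = inj₂ (inj₂
          ( trans (sym ΔX′≡ΔX) (Δ-cong {X′} {A} X′≈A)
          , x , e , x∈A , e∈A , Ends⇒Incident (swap ends) , ¬loop ends
          , λ e′∈A inc′ → [ (λ e′∈X → contradiction (incident-∈ X e′∈X inc′) x∉X) , id ]′
              (x∈p∪⁅y⁆⁻ (proj₂ (≈⇒⊇ {X′} {A} X′≈A) e′∈A)) ))
        new (inj₂ (inj₁ lt)) = inj₂ (inj₁ (subst (ℤ._< Δ A) ΔX′≡ΔX lt))
        -- The leaf found later is a leaf of `A` itself, not of an intermediate graph, so it can be
        -- passed on.
        new (inj₂ (inj₂ (eq , leaf))) = inj₂ (inj₂ (trans (sym ΔX′≡ΔX) eq , leaf))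

      extend : ∀ n → ∣ edges A ∣ ℕ.≤ n + ∣ edges X ∣ → Growth X A
      extend zero ∣A∣≤ = contradiction
        (ℕ.≤-trans (subst (ℕ._≤ ∣ edges A ∣) ∣X′∣ (p⊆q⇒∣p∣≤∣q∣ (proj₂ X′⊆A))) ∣A∣≤)
        (ℕ.1+n≰n)
      extend (suc n) ∣A∣≤ = conclude (go n X′ X′⊆A (map₂ (p⊆p∪q ⁅ x ⁆) ne)
        (subst (∣ edges A ∣ ℕ.≤_) (trans (sym (ℕ.+-suc n _)) (cong (λ k → n + k) (sym ∣X′∣))) ∣A∣≤))

  Δ-mono-≤ : Connected A → X ⊆ A → Subset.Nonempty (vertices X) → Δ X ℤ.≤ Δ A
  Δ-mono-≤ {A} {X} conn X⊆A ne = Growth⇒Δ≤ {X} {A} (growth {A} {X} conn X⊆A ne)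

  Δ-mono-< : Connected A → NoLeaves A → X ⊆ A → ¬ A ⊆ X → Subset.Nonempty (vertices X) →
    Δ X ℤ.< Δ A
  Δ-mono-< {A} {X} conn nl X⊆A A⊈X ne with growth {A} {X} conn X⊆A ne
  ... | inj₁ X≈A                    = contradiction (≈⇒⊇ {X} {A} X≈A) A⊈X
  ... | inj₂ (inj₁ lt)              = lt
  ... | inj₂ (inj₂ (_ , v , leaf))  = contradiction leaf (nl v)

  -- Finding cycles

  -- A class contains every edge of `X` at each of its vertices, so degrees in the class equal
  -- degrees in `X`.
  class-cycle : (c : ComponentColouring X) → v ∈ vertices X →
    (∀ {u} → u ∈ vertices X → degree X u ≡ 2) →
    IsCycle (ComponentColouring.class c (ComponentColouring.colour c v))
  class-cycle {X} {v} c v∈X deg≡2 = class-connected v∈X , λ u∈ →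
    let (u∈X , c≡r) = ∈-class⁻ u∈ in trans
      (cong₂ _+_ (cong ∣_∣ (fibres end₁ inj₁ c≡r)) (cong ∣_∣ (fibres end₂ inj₂ c≡r)))
      (deg≡2 u∈X)
    where
    open ComponentColouring c
    fibres : (end : Fin #E → Fin #V) → (∀ {e u} → end e ≡ u → e ∋ u) → colour u ≡ r →
      edges (class r) ∩ preimage end u ≡ edges X ∩ preimage end u
    fibres end inc c≡r = Subset.⊆-antisym
      (λ e∈ → let (e∈C , e∈u) = x∈p∩q⁻ _ _ e∈ in x∈p∩q⁺ (proj₁ (edge-∈-class⁻ e∈C) , e∈u))
      (λ e∈ → let (e∈X , e∈u) = x∈p∩q⁻ _ _ e∈ in
        x∈p∩q⁺ (edge-∈-class⁺ e∈X (inc (∈-preimage⁻ end e∈u)) c≡r , e∈u))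

  remove-vertex : (X : Subgraph G) (v : Fin #V) → ¬ (∃ λ e → e ∈ edges X × e ∋ v) → Subgraph G
  remove-vertex X v isolated = record
    { vertices = vertices X - v
    ; edges    = edges X
    ; closed   = λ e∈X →
        x∈p∧x≢y⇒x∈p-y (proj₁ (closed X e∈X)) (λ p → isolated (_ , e∈X , inj₁ p)) ,
        x∈p∧x≢y⇒x∈p-y (proj₂ (closed X e∈X)) (λ p → isolated (_ , e∈X , inj₂ p))
    }

  remove-edge : Subgraph G → Fin #E → Subgraph G
  remove-edge X e = record
    { vertices = vertices X
    ; edges    = edges X - e
    ; closed   = closed X ∘ proj₁ ∘ x∈p-y⁻
    }

  -- Isolated vertices, leaves, and (if |V| < |E|) arbitrary edges may be removed; when none of
  -- this is possible, all degrees are 2.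
  contains-cycle : (X : Subgraph G) → Subset.Nonempty (vertices X) →
    ∣ vertices X ∣ ℕ.≤ ∣ edges X ∣ → ∃ λ C → C ⊆ X × IsCycle C
  contains-cycle X₀ = go _ X₀ ℕ.≤-refl
    where
    within : Y ⊆ X → (∃ λ C → C ⊆ Y × IsCycle C) → ∃ λ C → C ⊆ X × IsCycle C
    within {Y} {X} Y⊆X (C , C⊆Y , cyc) = C , ⊆-trans {C} {Y} {X} C⊆Y Y⊆X , cyc

    edge : ∀ X → Subset.Nonempty (vertices X) → ∣ vertices X ∣ ℕ.≤ ∣ edges X ∣ →
      Subset.Nonempty (edges X)
    edge X (v , v∈X) V≤E = 1≤∣p∣⇒Nonempty (ℕ.≤-trans (x∈p⇒1≤∣p∣ v∈X) V≤E)

    go : ∀ n X → ∣ vertices X ∣ + ∣ edges X ∣ ℕ.≤ n → Subset.Nonempty (vertices X) →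
      ∣ vertices X ∣ ℕ.≤ ∣ edges X ∣ → ∃ λ C → C ⊆ X × IsCycle C
    go zero X size (v , v∈X) V≤E =
      contradiction (ℕ.≤-trans (ℕ.m≤n⇒m≤n+o _ (x∈p⇒1≤∣p∣ v∈X)) size) λ ()
    go (suc n) X size ne V≤E
      with any? (λ v → v ∈? vertices X ×-dec ¬? (any? λ e → e ∈? edges X ×-dec e ∋? v))
    ... | yes (v , v∈X , isolated) = within {X′} {X} (proj₁ ∘ x∈p-y⁻ , id)
      (go n X′ (ℕ.≤-pred (subst (λ k → k + ∣ edges X ∣ ℕ.≤ suc n) V size))
        -- An edge exists because 1 ≤ |V| ≤ |E|, and its ends are not the isolated vertex removed.
        (_ , proj₁ (closed X′ (proj₂ (edge X ne V≤E))))
        (ℕ.≤-trans (ℕ.n≤1+n _) (subst (ℕ._≤ ∣ edges X ∣) V V≤E)))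
      where
      X′ = remove-vertex X v isolated
      V : ∣ vertices X ∣ ≡ suc ∣ vertices X′ ∣
      V = ∣p∣≡1+∣p-x∣ v∈X
    ... | no ¬isolated with any? (λ v → any? (leafWithEdge? X v))
    ...   | yes (v , e , leaf@(_ , e∈X , _ , ¬loop , _)) = within {X′} {X} (⇝-⊆ {X} {X′} X⇝X′)
      (go n X′ (ℕ.≤-pred (ℕ.≤-trans (ℕ.s≤s (ℕ.+-monoʳ-≤ _ (ℕ.n≤1+n _)))
                (subst₂ (λ k l → k + l ℕ.≤ suc n) V E size)))
        -- The edge at the leaf is no loop, so its other end remains.
        (1≤∣p∣⇒Nonempty (ℕ.≤-pred (subst (2 ℕ.≤_) V
          (x≢y∈p⇒2≤∣p∣ (proj₁ (closed X e∈X)) (proj₂ (closed X e∈X)) ¬loop))))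
        (ℕ.≤-pred (subst₂ ℕ._≤_ V E V≤E)))
      where
      X′   = proj₁ (remove-leaf {X} leaf)
      X⇝X′ = proj₂ (remove-leaf {X} leaf)
      V   = ⇝-∣vertices∣ {X} {X′} X⇝X′
      E   = ⇝-∣edges∣ {X} {X′} X⇝X′
    ...   | no ¬leaf with leafless⇒degrees≡2⊎∣V∣<∣E∣ {X}
              (λ {v} v∈X → decidable-stable (any? λ e → e ∈? edges X ×-dec e ∋? v)
                λ isolated → ¬isolated (v , v∈X , isolated))
              (λ v leaf → ¬leaf (v , leaf))
    ...     | inj₁ deg≡2 = class (colour (proj₁ ne)) , class-⊆ , class-cycle c (proj₂ ne) deg≡2
      where
      c = componentColouring X
      open ComponentColouring c
    ...     | inj₂ V<E = within {X′} {X} (id , proj₁ ∘ x∈p-y⁻)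
      (go n X′ (ℕ.≤-pred (subst (ℕ._≤ suc n)
                 (trans (cong (λ k → ∣ vertices X ∣ + k) E) (ℕ.+-suc _ _)) size))
        ne (ℕ.≤-pred (subst (∣ vertices X ∣ ℕ.<_) E V<E)))
      where
      e∈X = proj₂ (edge X ne V≤E)
      X′   = remove-edge X (proj₁ (edge X ne V≤E))
      E : ∣ edges X ∣ ≡ suc ∣ edges X′ ∣
      E = ∣p∣≡1+∣p-x∣ e∈X

  Empty⇒Δ≡0 : (X : Subgraph G) → Subset.Empty (vertices X) → Δ X ≡ + 0
  Empty⇒Δ≡0 X empty = cong₂ _⊖_
    (trans (cong ∣_∣ (Empty-unique λ { (e , e∈X) → empty (_ , proj₁ (closed X e∈X)) })) (∣⊥∣≡0 #E))
    (trans (cong ∣_∣ (Empty-unique empty)) (∣⊥∣≡0 #V))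

  -- Positive `Δ` provides an edge. A walk from `v` to one of its ends either begins with an edge at
  -- `v` or is empty, and then the edge itself meets `v`.
  connected⇒NoIsolated : Connected X → + 0 ℤ.< Δ X → NoIsolated X
  connected⇒NoIsolated {X} (_ , walk) 0<Δ {v} v∈X =
    first (proj₂ edge) (inj₁ refl) (walk v∈X (proj₁ (closed X (proj₂ edge))))
    where
    edge : Subset.Nonempty (edges X)
    edge = 1≤∣p∣⇒Nonempty
      (ℕ.≤-<-trans z≤n (0<n⊖m⇒m<n {∣ vertices X ∣} {∣ edges X ∣} 0<Δ))
    first : e ∈ edges X → e ∋ u → Star (Adjacent X) v u → ∃ λ e → e ∈ edges X × e ∋ v
    first e∈X inc ε = _ , e∈X , inc
    first _ _ ((e , e∈X , ends) ◅ _) = e , e∈X , Ends⇒Incident ends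

  -- Assembling a subgraph from a subgraph of each component of G

  open ComponentColouring (componentColouring (whole G))

  ⊆-whole : X ⊆ whole G
  ⊆-whole = ⊆⊤ , ⊆⊤

  module Glue (part : Fin #V → Subgraph G) (part⊆class : ∀ r → part r ⊆ class r) where

    glue : Subgraph G
    glue = record
      { vertices = sift (λ v → v ∈? vertices (part (colour v)))
      ; edges    = sift (λ e → e ∈? edges (part (colour (end₁ e))))
      ; closed   = λ {e} e∈ →
          let (p , q) = closed (part _) (∈-sift⁻ (λ e → e ∈? edges (part (colour (end₁ e)))) e∈) in
          ∈-sift⁺ (λ v → v ∈? vertices (part (colour v))) p ,
          ∈-sift⁺ (λ v → v ∈? vertices (part (colour v)))
            -- The edge is filed under the colour of its first end, which is also that of its second
            -- end.
            (subst (λ r → end₂ e ∈ vertices (part r)) (respects ∈⊤) q)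
      }

    ∈-glue⁺ : v ∈ vertices (part (colour v)) → v ∈ vertices glue
    ∈-glue⁺ = ∈-sift⁺ (λ v → v ∈? vertices (part (colour v)))

    ∈-glue⁻ : v ∈ vertices glue → v ∈ vertices (part (colour v))
    ∈-glue⁻ = ∈-sift⁻ (λ v → v ∈? vertices (part (colour v)))

    edge-∈-glue⁺ : e ∈ edges (part (colour (end₁ e))) → e ∈ edges glue
    edge-∈-glue⁺ = ∈-sift⁺ (λ e → e ∈? edges (part (colour (end₁ e))))

    edge-∈-glue⁻ : e ∈ edges glue → e ∋ v → e ∈ edges (part (colour v))
    edge-∈-glue⁻ {e} e∈ inc = subst (λ r → e ∈ edges (part r)) (respects-Incident ∈⊤ inc)
      (∈-sift⁻ (λ e → e ∈? edges (part (colour (end₁ e)))) e∈)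

    part-⊆-glue : part r ⊆ glue
    part-⊆-glue {r} =
      (λ {v} v∈ → ∈-glue⁺ (subst (λ r → v ∈ vertices (part r))
        (sym (proj₂ (∈-class⁻ (proj₁ (part⊆class r) v∈)))) v∈)) ,
      (λ {e} e∈ → edge-∈-glue⁺ (subst (λ r → e ∈ edges (part r))
        (sym (proj₂ (edge-∈-class⁻ (proj₂ (part⊆class r) e∈)))) e∈))

    glueColouring : Colouring glue
    glueColouring = restrict colouring (⊆-whole {glue})

    open Colouring glueColouring using ()
      renaming (class to glueClass; Δ-classes to Δ-glueClasses;
        ∈-class⁺ to ∈-glueClass⁺; edge-∈-class⁺ to edge-∈-glueClass⁺;
        ∈-class⁻ to ∈-glueClass⁻; edge-∈-class⁻ to edge-∈-glueClass⁻)

    glueClass-≈ : ∀ r → glueClass r ≈ part r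
    glueClass-≈ r = ⊆-antisym {glueClass r} {part r}
      ( (λ v∈ → let (v∈glue , c≡r) = ∈-glueClass⁻ v∈ in
          subst (λ r → _ ∈ vertices (part r)) c≡r (∈-glue⁻ v∈glue))
      , (λ e∈ → let (e∈glue , c≡r) = edge-∈-glueClass⁻ e∈ in
          subst (λ r → _ ∈ edges (part r)) c≡r (edge-∈-glue⁻ e∈glue (inj₁ refl))))
      ( (λ v∈ → ∈-glueClass⁺ (proj₁ part-⊆-glue v∈) (proj₂ (∈-class⁻ (proj₁ (part⊆class r) v∈))))
      , (λ e∈ → edge-∈-glueClass⁺ (proj₂ part-⊆-glue e∈) (inj₁ refl)
          (proj₂ (edge-∈-class⁻ (proj₂ (part⊆class r) e∈)))))

    Δ-glue : Δ glue ≡ ℤΣ.sum (Δ ∘ part)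
    Δ-glue = trans Δ-glueClasses
      (ℤΣ.sum-cong-≗ λ r → Δ-cong {glueClass r} {part r} (glueClass-≈ r))

  empty : Subgraph G
  empty = record { vertices = Subset.⊥ ; edges = Subset.⊥ ; closed = λ e∈⊥ → contradiction e∈⊥ ∉⊥ }

  infix 5 _onlyIf_

  -- A discarded component is replaced by `empty`, whose `Δ` is 0, so that sums can still run over
  -- all colours.
  _onlyIf_ : {P : Set} → Subgraph G → Dec P → Subgraph G
  X onlyIf yes _ = X
  X onlyIf no  _ = empty

  onlyIf-true : {P : Set} (P? : Dec P) → P → X onlyIf P? ≡ X
  onlyIf-true (yes _) _ = refl
  onlyIf-true (no ¬p) p = contradiction p ¬p

  onlyIf-⊆ : {P : Set} (P? : Dec P) → X onlyIf P? ⊆ X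
  onlyIf-⊆ {X} (yes _) = ⊆-refl {X}
  onlyIf-⊆ (no _)  = ⊥⊆ , ⊥⊆

  onlyIf-∈ : {P : Set} (P? : Dec P) → v ∈ vertices (X onlyIf P?) → P × X onlyIf P? ≡ X
  onlyIf-∈ (yes p) _   = p , refl
  onlyIf-∈ (no _)  v∈⊥ = contradiction v∈⊥ ∉⊥

  -- The core

  -- Computed for every colour; a tree component, for instance, prunes to a single vertex.
  -- `corePart` keeps only those from components with positive `Δ`.
  kernel : Fin #V → Subgraph G
  kernel r = proj₁ (prune (class r))

  class⇝*kernel : ∀ r → Star _⇝_ (class r) (kernel r)
  class⇝*kernel r = proj₁ (proj₂ (prune (class r)))

  kernel-NoLeaves : ∀ r → NoLeaves (kernel r)
  kernel-NoLeaves r = proj₂ (proj₂ (prune (class r)))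

  0<Δ? : ∀ r → Dec (+ 0 ℤ.< Δ (class r))
  0<Δ? r = + 0 ℤ.<? Δ (class r)

  corePart : Fin #V → Subgraph G
  corePart r = kernel r onlyIf 0<Δ? r

  corePart⊆class : ∀ r → corePart r ⊆ class r
  corePart⊆class r = ⊆-trans {corePart r} {kernel r} {class r}
    (onlyIf-⊆ {kernel r} (0<Δ? r)) (⇝*-⊆ (class⇝*kernel r))

  open Glue corePart corePart⊆class renaming
    (glue to core; glueColouring to coreColouring; glueClass-≈ to coreClass-≈; Δ-glue to Δ-core)

  corePart-kernel : v ∈ vertices (corePart r) → + 0 ℤ.< Δ (class r) × corePart r ≡ kernel r
  corePart-kernel {r = r} = onlyIf-∈ (0<Δ? r)

  corePart-0<Δ : v ∈ vertices (corePart r) → + 0 ℤ.< Δ (corePart r)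
  corePart-0<Δ {r = r} v∈ with corePart-kernel v∈
  ... | 0<Δ , eq rewrite eq = subst (+ 0 ℤ.<_) (⇝*-Δ (class⇝*kernel r)) 0<Δ

  corePart-Connected : v ∈ vertices (corePart r) → Connected (corePart r)
  -- The vertex `v` shows that `r` is the colour `colour v`, hence that the class is a genuine
  -- component.
  corePart-Connected {v} {r} v∈ with ∈-class⁻ (proj₁ (corePart⊆class r) v∈) | corePart-kernel v∈
  ... | _ , refl | _ , eq rewrite eq = ⇝*-Connected (class⇝*kernel r) (class-connected {v} ∈⊤)

  corePart-NoLeaves : NoLeaves (corePart r)
  corePart-NoLeaves {r} u leaf@(_ , u∈ , _) with corePart-kernel u∈
  ... | _ , eq = subst NoLeaves (sym eq) (kernel-NoLeaves r) u leaf

  corePart-NoIsolated : NoIsolated (corePart r)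
  corePart-NoIsolated {r} v∈ =
    connected⇒NoIsolated {corePart r} (corePart-Connected v∈) (corePart-0<Δ v∈) v∈

  -- `B` lies in one component of `G`, whose `Δ` is at least that of `B` and hence positive; pruning
  -- this component spares `B`. Applied both to components of cacti-graphs and to kernels.
  ⊆-core : Connected B → NoIsolated B → NoLeaves B → + 0 ℤ.< Δ B → B ⊆ core
  ⊆-core {B} conn@((v , v∈B) , _) ni nl 0<Δ = ⊆-trans {B} {corePart c} {core} B⊆part part-⊆-glue
    where
    c = colour v
    B⊆class : B ⊆ class c
    B⊆class = connected-⊆-class {B} (⊆-whole {B}) conn v∈B
    0<Δclass : + 0 ℤ.< Δ (class c)
    0<Δclass = ℤ.<-≤-trans 0<Δ (Δ-mono-≤ {class c} {B} (class-connected {v} ∈⊤) B⊆class (v , v∈B))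
    B⊆part : B ⊆ corePart c
    B⊆part = subst (B ⊆_) (sym (onlyIf-true {kernel c} (0<Δ? c) 0<Δclass))
      (⇝*-preserves-leafless {B} ni nl (class⇝*kernel c) B⊆class)

  core-IsCacti : IsCacti core
  core-IsCacti = ni , nl , noCycle
    where
    ni : NoIsolated core
    ni v∈ = let (e , e∈ , inc) = corePart-NoIsolated (∈-glue⁻ v∈) in e , proj₂ part-⊆-glue e∈ , inc
    nl : NoLeaves core
    nl v (e , v∈ , e∈ , inc , ¬loop , uniq) = corePart-NoLeaves v
      (e , ∈-glue⁻ v∈ , edge-∈-glue⁻ e∈ inc , inc , ¬loop , uniq ∘ proj₂ part-⊆-glue)
    -- By maximality `D` is a whole core part, with positive `Δ`, whereas a cycle has `Δ` equal to
    -- 0.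
    noCycle : ∀ D → IsComponent core D → ¬ IsCycle D
    noCycle D (D⊆core , conn@((v , v∈D) , _) , max) cyc =
      ℤ.<-irrefl (sym (trans (Δ-cong {C} {D} C≈D) (cycle-Δ {D} cyc))) (corePart-0<Δ v∈C)
      where
      C = corePart (colour v)
      v∈C : v ∈ vertices C
      v∈C = ∈-glue⁻ (proj₁ D⊆core v∈D)
      D⊆C : D ⊆ C
      D⊆C = ⊆-trans {D} {Colouring.class coreColouring (colour v)} {C}
        (Colouring.connected-⊆-class coreColouring {D} D⊆core conn v∈D)
        (≈⇒⊆ {Colouring.class coreColouring (colour v)} {C} (coreClass-≈ (colour v)))
      C≈D : C ≈ D
      C≈D = ⊆-antisym {C} {D} (max C part-⊆-glue (corePart-Connected v∈C) D⊆C) D⊆C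

  cacti-⊆-core : IsCacti X → X ⊆ core
  cacti-⊆-core {X} (ni , nl , noCycle) =
    (λ v∈X → proj₁ (component-⊆ v∈X) (CX.∈-class⁺ v∈X refl)) ,
    (λ e∈X → proj₂ (component-⊆ (proj₁ (closed X e∈X))) (CX.edge-∈-class⁺ e∈X (inj₁ refl) refl))
    where
    module CX = ComponentColouring (componentColouring X)
    component-⊆ : v ∈ vertices X → CX.class (CX.colour v) ⊆ core
    component-⊆ {v} v∈X = ⊆-core {D} conn ni-D nl-D (m<n⇒0<n⊖m ([ cycle , id ]′
      (leafless⇒degrees≡2⊎∣V∣<∣E∣ {D} ni-D nl-D)))
      where
      D    = CX.class (CX.colour v)
      conn = CX.class-connected v∈X
      ni-D : NoIsolated D
      ni-D = CX.class-NoIsolated ni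
      nl-D : NoLeaves D
      nl-D = CX.class-NoLeaves nl
      cycle : (∀ {u} → u ∈ vertices D → degree D u ≡ 2) → ∣ vertices D ∣ ℕ.< ∣ edges D ∣
      cycle deg≡2 = ⊥-elim (noCycle D (CX.class-IsComponent v∈X) (conn , deg≡2))

  core-IsMaximum : IsMaximum IsCacti core
  core-IsMaximum = core-IsCacti , λ X → cacti-⊆-core {X}

  core-IsCore : IsCore (whole G) core
  core-IsCore =
    (λ v → mk⇔ (λ v∈ → let v∈part = ∈-glue⁻ v∈ in _ , witness v∈part , v∈part)
               (λ { (K , isK , v∈K) → proj₁ (kernel-⊆ isK) v∈K })) ,
    (λ e → mk⇔ (λ e∈ → let e∈part = edge-∈-glue⁻ e∈ (inj₁ refl) in
                 _ , witness (proj₁ (closed (corePart _) e∈part)) , e∈part)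
               (λ { (K , isK , e∈K) → proj₂ (kernel-⊆ isK) e∈K }))
    where
    IsCoreKernel : Subgraph G → Set
    IsCoreKernel K = ∃ λ A → IsComponent (whole G) A × + 1 ℤ.≤ Δ A × IsKernel A K

    witness : v ∈ vertices (corePart (colour v)) → IsCoreKernel (corePart (colour v))
    witness {v} v∈ with corePart-kernel v∈
    ... | 0<Δ , eq rewrite eq = class (colour v) , class-IsComponent ∈⊤ ,
      ℤ.i<j⇒suc[i]≤j 0<Δ , class⇝*kernel (colour v) , kernel-NoLeaves (colour v)

    -- `K` may come from any order of leaf deletions, not only the one chosen by `prune`; being
    -- connected and leafless with positive `Δ`, it lies in `core` all the same.
    kernel-⊆ : IsCoreKernel K → K ⊆ core
    kernel-⊆ {K} (A , (_ , conn , _) , 1≤Δ , A⇝*K , nl) =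
      ⊆-core {K} connK (connected⇒NoIsolated {K} connK 0<ΔK) nl 0<ΔK
      where
      connK = ⇝*-Connected A⇝*K conn
      0<ΔK : + 0 ℤ.< Δ K
      0<ΔK = subst (+ 0 ℤ.<_) (⇝*-Δ A⇝*K) (ℤ.suc[i]≤j⇒i<j 1≤Δ)

  -- Tree components

  0≤Δ? : ∀ r → Dec (+ 0 ℤ.≤ Δ (class r))
  0≤Δ? r = + 0 ℤ.≤? Δ (class r)

  nonTreePart : Fin #V → Subgraph G
  nonTreePart r = class r onlyIf 0≤Δ? r

  nonTreePart⊆class : ∀ r → nonTreePart r ⊆ class r
  nonTreePart⊆class r = onlyIf-⊆ {class r} (0≤Δ? r)

  module NonTree = Glue nonTreePart nonTreePart⊆class

  treesRemoved : Subgraph G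
  treesRemoved = NonTree.glue

  -- A tree component through `v` would be the class of `v`, with |V| ≤ |E|, and so would contain a
  -- cycle.
  0≤Δ⇒∉Tree : + 0 ℤ.≤ Δ (class (colour v)) → TreeComponent (whole G) T → v ∉ vertices T
  0≤Δ⇒∉Tree {v} {T} 0≤Δ (isComp , _ , acyclic) v∈T =
    let (C , C⊆T , cyc) = contains-cycle T (v , v∈T)
          (0≤n⊖m⇒m≤n {∣ vertices T ∣} {∣ edges T ∣} (subst (+ 0 ℤ.≤_) (sym ΔT≡) 0≤Δ))
    in acyclic C C⊆T cyc
    where
    ΔT≡ : Δ T ≡ Δ (class (colour v))
    ΔT≡ = Δ-cong {T} {class (colour v)} (component-≈-class {T} isComp v∈T)

  -- A cycle inside the class would have `Δ` equal to 0, and passing to the connected class around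
  -- it cannot lower `Δ`.
  Δ<0⇒TreeComponent : ¬ + 0 ℤ.≤ Δ (class (colour v)) → TreeComponent (whole G) (class (colour v))
  Δ<0⇒TreeComponent {v} Δ<0 = class-IsComponent {v} ∈⊤ , class-connected {v} ∈⊤ ,
    λ C C⊆ cyc → Δ<0 (subst (ℤ._≤ Δ (class (colour v))) (cycle-Δ {C} cyc)
      (Δ-mono-≤ {class (colour v)} {C} (class-connected {v} ∈⊤) C⊆ (proj₁ (proj₁ cyc))))

  treesRemoved-RemovesTrees : RemovesTrees (whole G) treesRemoved
  treesRemoved-RemovesTrees =
    (λ v → mk⇔
      (λ v∈ → ∈⊤ , λ T → 0≤Δ⇒∉Tree {T = T} (0≤Δ v∈))
      (λ { (_ , noTree) → NonTree.∈-glue⁺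
        (kept v {λ X → v ∈ vertices X} (∈-class⁺ ∈⊤ refl) noTree) })) ,
    (λ e → mk⇔
      (λ e∈ → ∈⊤ , λ T tree e∈T →
        0≤Δ⇒∉Tree {T = T} (0≤Δ (proj₁ (closed treesRemoved e∈))) tree (proj₁ (closed T e∈T)))
      (λ { (_ , noTree) → NonTree.edge-∈-glue⁺
        (kept (end₁ e) {λ X → e ∈ edges X} (edge-∈-class⁺ ∈⊤ (inj₁ refl) refl) noTree) }))
    where
    0≤Δ : v ∈ vertices treesRemoved → + 0 ℤ.≤ Δ (class (colour v))
    0≤Δ {v} v∈ = proj₁ (onlyIf-∈ {X = class (colour v)} (0≤Δ? (colour v)) (NonTree.∈-glue⁻ v∈))

    -- The predicate `M` stands for containing a given vertex or a given edge, so one argument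
    -- serves both.
    kept : ∀ v {M : Subgraph G → Set} → M (class (colour v)) →
      (∀ T → TreeComponent (whole G) T → ¬ M T) → M (nonTreePart (colour v))
    kept v {M} m noTree = subst M (sym (onlyIf-true (0≤Δ? (colour v)) 0≤Δclass)) m
      where
      0≤Δclass : + 0 ℤ.≤ Δ (class (colour v))
      0≤Δclass = decidable-stable (0≤Δ? (colour v)) λ Δ<0 →
        noTree (class (colour v)) (Δ<0⇒TreeComponent Δ<0) m

  Δ-core≡Δ-treesRemoved : Δ core ≡ Δ treesRemoved
  Δ-core≡Δ-treesRemoved = trans Δ-core (trans
    (ℤΣ.sum-cong-≗ λ r → compare r (0<Δ? r) (0≤Δ? r)) (sym NonTree.Δ-glue))
    where
    Δ-empty : Δ empty ≡ + 0
    Δ-empty = Empty⇒Δ≡0 empty λ { (v , v∈⊥) → ∉⊥ v∈⊥ }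
    compare : ∀ r (0<Δ? : Dec (+ 0 ℤ.< Δ (class r))) (0≤Δ? : Dec (+ 0 ℤ.≤ Δ (class r))) →
      Δ (kernel r onlyIf 0<Δ?) ≡ Δ (class r onlyIf 0≤Δ?)
    compare r (yes 0<Δ) (yes _)   = sym (⇝*-Δ (class⇝*kernel r))
    compare r (yes 0<Δ) (no  Δ<0) = contradiction (ℤ.<⇒≤ 0<Δ) Δ<0
    compare r (no  Δ≤0) (yes 0≤Δ) = trans Δ-empty (ℤ.≤-antisym 0≤Δ (ℤ.≮⇒≥ Δ≤0))
    compare r (no  _)   (no  _)   = refl

  -- `X` is cut along the components of `G`. No piece exceeds the `Δ` of its core part, and a piece
  -- short of the full part has strictly smaller `Δ`, so equal totals force every piece to be full.
  core-⊆-of-Δ≡ : X ⊆ core → Δ X ≡ Δ core → core ⊆ X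
  core-⊆-of-Δ≡ {X} X⊆core ΔX≡Δcore =
    (λ v∈ → proj₁ (part-⊆ (∈-glue⁻ v∈)) (∈-glue⁻ v∈)) ,
    (λ e∈ → let e∈part = edge-∈-glue⁻ e∈ (inj₁ refl) in
      proj₂ (part-⊆ (proj₁ (closed (corePart _) e∈part))) e∈part)
    where
    open Colouring (restrict {X = X} colouring (⊆-whole {X})) using ()
      renaming (class to classX; Δ-classes to Δ-classesX; class-⊆ to classX-⊆;
        ∈-class⁻ to ∈-classX⁻; edge-∈-class⁻ to edge-∈-classX⁻)
    module Core = Colouring coreColouring

    classX-⊆-part : ∀ r → classX r ⊆ corePart r
    classX-⊆-part r = ⊆-trans {classX r} {Core.class r} {corePart r}
      ( (λ v∈ → let (v∈X , c≡r) = ∈-classX⁻ v∈ in Core.∈-class⁺ (proj₁ X⊆core v∈X) c≡r)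
      , (λ e∈ → let (e∈X , c≡r) = edge-∈-classX⁻ e∈ in
          Core.edge-∈-class⁺ (proj₂ X⊆core e∈X) (inj₁ refl) c≡r))
      (≈⇒⊆ {Core.class r} {corePart r} (coreClass-≈ r))

    Δ-≤ : ∀ r → Δ (classX r) ℤ.≤ Δ (corePart r)
    Δ-≤ r with nonempty? (vertices (classX r)) | nonempty? (vertices (corePart r))
    ... | yes ne@(v , v∈) | _ = Δ-mono-≤ {corePart r} {classX r}
      (corePart-Connected (proj₁ (classX-⊆-part r) v∈)) (classX-⊆-part r) ne
    -- Growth needs a vertex to start from. An empty piece has `Δ` equal to 0 instead, below the
    -- positive `Δ` of the core part.
    ... | no ¬ne | yes (v , v∈) =
      subst (ℤ._≤ Δ (corePart r)) (sym (Empty⇒Δ≡0 (classX r) ¬ne)) (ℤ.<⇒≤ (corePart-0<Δ v∈))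
    ... | no ¬ne | no ¬ne′ =
      ℤ.≤-reflexive (trans (Empty⇒Δ≡0 (classX r) ¬ne) (sym (Empty⇒Δ≡0 (corePart r) ¬ne′)))

    Δ-< : v ∈ vertices (corePart r) → ¬ corePart r ⊆ classX r → Δ (classX r) ℤ.< Δ (corePart r)
    Δ-< {r = r} v∈ part⊈ with nonempty? (vertices (classX r))
    ... | yes ne = Δ-mono-< {corePart r} {classX r} (corePart-Connected v∈) (corePart-NoLeaves {r})
      (classX-⊆-part r) part⊈ ne
    ... | no ¬ne = subst (ℤ._< Δ (corePart r)) (sym (Empty⇒Δ≡0 (classX r) ¬ne)) (corePart-0<Δ v∈)

    part-⊆ : v ∈ vertices (corePart r) → corePart r ⊆ X
    part-⊆ {r = r} v∈ = ⊆-trans {corePart r} {classX r} {X}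
      (decidable-stable (vertices (corePart r) ⊆? _ ×-dec edges (corePart r) ⊆? _) λ part⊈ →
        ℤ.<-irrefl ΔX≡Δcore (subst₂ ℤ._<_ (sym Δ-classesX) (sym Δ-core)
          (ℤ-MonotoneSum.sum-mono-< Δ-≤ r (Δ-< v∈ part⊈))))
      classX-⊆

  -- The properties of a subgraph considered here do not mention the field closed.

  IsMaximumCacti-resp-≈ : X ≈ Y → IsMaximum IsCacti X → IsMaximum IsCacti Y
  IsMaximumCacti-resp-≈ {record {}} {record {}} (refl , refl) = id

  IsUnion-resp-≈ : {P : Subgraph G → Set} → X ≈ Y → IsUnion P X → IsUnion P Y
  IsUnion-resp-≈ {record {}} {record {}} (refl , refl) = id

  IsUnion⇔≈ : {P : Subgraph G → Set} → IsUnion P X → IsUnion P Y ⇔ Y ≈ X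
  IsUnion⇔≈ {X} {Y} (V , E) = mk⇔ (λ (V′ , E′) → ≐⇒≡ V′ V , ≐⇒≡ E′ E)
    (λ Y≈X → IsUnion-resp-≈ {X} {Y} (≈-sym {Y} {X} Y≈X) (V , E))

  -- Reduces a characterisation by uniqueness to `F ≈ core` once `core` is known to satisfy it.
  -- Uniqueness is up to `≈`, so the property has to respect `≈`.
  IsUnique⇔≈ : {P : Subgraph G → Set} → (∀ {X Y} → X ≈ Y → P X → P Y) →
    IsUnique P X → IsUnique P Y ⇔ Y ≈ X
  IsUnique⇔≈ {X} {Y} resp (p , unique) = mk⇔
    (λ (_ , unique′) → ≈-sym {X} {Y} (unique′ X p)) λ Y≈X →
    resp {X} {Y} (≈-sym {Y} {X} Y≈X) p ,
    λ Z q → ≈-trans {Z} {X} {Y} (unique Z q) (≈-sym {Y} {X} Y≈X)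

  IsMaximum⇒IsUnique : {P : Subgraph G → Set} → IsMaximum P X → IsUnique (IsMaximum P) X
  IsMaximum⇒IsUnique {X} (p , max) = (p , max) ,
    λ Y (q , max′) → ⊆-antisym {Y} {X} (max Y q) (max′ X p)

  RemovesTrees-unique : RemovesTrees X Y → RemovesTrees X Z → Y ≈ Z
  RemovesTrees-unique (V , E) (V′ , E′) = ≐⇒≡ V V′ , ≐⇒≡ E E′

  CactiOfΔ : Subgraph G → Subgraph G → Set
  CactiOfΔ G′ H = IsCacti H × Δ H ≡ Δ G′

  CactiOfΔ-resp-≈ : X ≈ Y → CactiOfΔ Z X → CactiOfΔ Z Y
  CactiOfΔ-resp-≈ {record {}} {record {}} (refl , refl) = id

  -- A competing cacti-graph lies in `core` by maximality, and then equal `Δ` forces equality. `Z`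
  -- is arbitrary with the right `Δ`, because (a3) speaks of any `G′` satisfying `RemovesTrees`.
  core-IsUnique : Δ Z ≡ Δ treesRemoved → IsUnique (CactiOfΔ Z) core
  core-IsUnique ΔZ≡ = (core-IsCacti , trans Δ-core≡Δ-treesRemoved (sym ΔZ≡)) ,
    λ X (cacti , ΔX≡) → ⊆-antisym {X} {core} (cacti-⊆-core {X} cacti)
      (core-⊆-of-Δ≡ {X} (cacti-⊆-core {X} cacti)
        (trans ΔX≡ (trans ΔZ≡ (sym Δ-core≡Δ-treesRemoved))))

  -- The three conditions as equality with the core

  module _ (F : Subgraph G) where

    IsCore⇔≈core : IsCore (whole G) F ⇔ F ≈ core
    IsCore⇔≈core = IsUnion⇔≈ {core} {F} core-IsCore

    maximumCacti⇔≈core : IsUnique (IsMaximum IsCacti) F ⇔ F ≈ core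
    maximumCacti⇔≈core = IsUnique⇔≈ {core} {F}
      (λ {X} {Y} → IsMaximumCacti-resp-≈ {X} {Y}) (IsMaximum⇒IsUnique {core} core-IsMaximum)

    cactiOfΔ⇔≈core :
      (∃ λ G′ → RemovesTrees (whole G) G′ × IsUnique (CactiOfΔ G′) F) ⇔ F ≈ core
    cactiOfΔ⇔≈core = mk⇔
      -- `RemovesTrees` determines `G′` up to `≈`, so its `Δ` is that of `treesRemoved`.
      (λ (G′ , removes , unique) → Equivalence.to (iff G′ (Δ-cong {G′} {treesRemoved}
        (RemovesTrees-unique {whole G} {G′} {treesRemoved} removes treesRemoved-RemovesTrees)))
        unique)
      (λ F≈core → treesRemoved , treesRemoved-RemovesTrees ,
        Equivalence.from (iff treesRemoved refl) F≈core)
      where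
      iff : ∀ G′ → Δ G′ ≡ Δ treesRemoved → IsUnique (CactiOfΔ G′) F ⇔ F ≈ core
      iff G′ ΔG′≡ = IsUnique⇔≈ {core} {F}
        (λ {X} {Y} → CactiOfΔ-resp-≈ {X} {Y} {G′}) (core-IsUnique {G′} ΔG′≡)

mainTheorem6 : (G : Graph) → NoIsolated (whole G) →
    (∃ λ A → IsComponent (whole G) A × AtLeastTwoCycles A) →
    (F : Subgraph G) → NoIsolated F →
    (IsCore (whole G) F ⇔ IsUnique (IsMaximum IsCacti) F) ×
    (IsUnique (IsMaximum IsCacti) F ⇔
    (∃ λ G′ → RemovesTrees (whole G) G′ ×
    IsUnique (λ H → IsCacti H × Δ H ≡ Δ G′) F))
mainTheorem6 G _ _ F _ =
  ⇔-sym (maximumCacti⇔≈core G F) ⇔-∘ IsCore⇔≈core G F ,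
  ⇔-sym (cactiOfΔ⇔≈core G F) ⇔-∘ maximumCacti⇔≈core G F
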